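{- In the combinatorial Marker-Cutter game with initial counter $g_0$, played against restricted Cutter, Marker has a strategy ensuring that the value of every game state is at most $\frac43 g_0+\frac{10}{3}$.
   Context: A set of boundary cycles is a pair $(D,\chi)$: $D$ a finite directed graph each of whose components is a directed cycle (loops allowed, no isolated vertices), $\chi:E(D)\to L$ an edge labelling; proper if each label is used on at most two edges. A game state is $\gamma=(D,\chi,g)$ with $(D,\chi)$ proper, $g\in\mathbb N_0$; its value $v(\gamma)$ is the number of distinct labels used. Combinatorial Marker-Cutter game: start with $D_0$ empty, $\chi_0$ empty and counter $g_0\in\mathbb N$. At turn $k$ with state $(D_k,\chi_k,g_k)$, Marker chooses $v,w$ (not necessarily distinct) from $V(D_k)\sqcup\{v_\gamma,w_\gamma\}$ (dummy vertices; each chosen dummy vertex, without multiplicity, is added as a new vertex). Let $C,C'$ be the components containing $v,w$. Splitting a vertex $u$ replaces it by a source $u_1$ (incident to the out-edge) and a sink $u_2$ (incident to the in-edge). If $C=C'$: splitting turns $C$ into a directed path $P$ from $v_1$ to $w_2$ and a directed path $P'$ from $w_1$ to $v_2$ (trivial paths with $v_1=w_2$, $v_2=w_1$ if $v=w$ is dummy); new edges $f=\overrightarrow{w_2v_1}$, $f'=\overrightarrow{v_2w_1}$; $\hat C_1=P\cup\{f\}$, $\hat C_2=P'\cup\{f'\}$. Cutter chooses (a) $D_{k+1}=\bar D\cup\hat C_1\cup\hat C_2$, $g_{k+1}=g_k-1$ (only if $g_k\ge1$); (b) $D_{k+1}=\bar D\cup\hat C_1$, $g_{k+1}=\bar g$;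 (c) $D_{k+1}=\bar D\cup\hat C_2$, $g_{k+1}=\bar g$; with $\bar D$ a union of components of $D_k\setminus C$, $0\le\bar g\le g_k$. If $C\ne C'$: splitting turns $C$ into a path $P$ from $v_1$ to $v_2$ (trivial if $v$ dummy) and $C'$ into $P'$ from $w_1$ to $w_2$; the only move (d) is $D_{k+1}=(D_k\cup\hat C)\setminus(C\cup C')$ with $\hat C=P\cup P'\cup\{\overrightarrow{w_2v_1},\overrightarrow{v_2w_1}\}$, $g_{k+1}=g_k$. In all cases old labels are kept and the new edges receive one common new label not previously used. A contraction contracts one edge (deleting resulting isolated vertices). $(D',\chi',g')$ is a reduction of $(D,\chi,g)$ if $g'\le g$, $D'$ is obtained from $D$ by contractions and $\chi'=\chi$ on $E(D')$. Game states are equivalent if they are isomorphic as labelled digraphs up to a bijective relabelling and have equal counters. Restricted Cutter may never make a move producing a game state equivalent to a reduction of an earlier game state (including the current one), and in moves (a), (b), (c) must take $\bar D=D_k\setminus C$ and $\bar g=g_k$; if restricted Cutter has no legal move, the game ends. -}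

module Defs where

open import Data.Nat using (ℕ; zero; suc; _+_; _∸_; _≤_; _≤ᵇ_; _<ᵇ_; _≡ᵇ_; _*_)
open import Data.Nat.Properties using (_≟_)
open import Data.Fin using (Fin; toℕ)
open import Data.List using (List; []; _∷_; _++_; [_]; length; lookup; take; drop; concat; map; deduplicate)
open import Data.List.Relation.Binary.Permutation.Propositional using (_↭_)
open import Data.List.Relation.Binary.Pointwise using (Pointwise)
open import Data.List.Membership.Propositional using (_∈_)
open import Data.List.Relation.Unary.Any using (Any)
open import Data.Bool using (Bool; true; false; if_then_else_)
open import Data.Product using (Σ; ∃; ∃₂; _×_; _,_; proj₁; proj₂)
open import Relation.Binary.PropositionalEquality using (_≡_)
open import Relation.Binary.Construct.Closure.ReflexiveTransitive using (Star)
open import Relation.Nullary using (¬_)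
open import Function.Definitions using (Injective)

-- Encoding of a set of boundary cycles (D, χ).
-- A directed cycle is encoded by the cyclic sequence of the labels of its
-- edges: the list [e₀, …, e_{n-1}] is the cycle whose j-th vertex is the
-- tail of e_j and the head of e_{j-1} (indices mod n).  A loop is a
-- one-element list.  Vertices carry no data, so this determines the
-- labelled digraph up to isomorphism.  A set of boundary cycles is a list
-- of (nonempty) cycles.  Labels are natural numbers.

Cycle : Set
Cycle = List ℕ

Boundary : Set
Boundary = List Cycle

record State : Set where
  constructor mkState
  field
    D : Boundary
    g : ℕ
open State public

value : State → ℕ
value s = length (deduplicate _≟_ (concat (D s)))

-- Vertices available to Marker: vertex j of cycle i of D, or one of the
-- two dummy vertices v_γ, w_γ.

data Vtx (B : Boundary) : Set where
  real : (i : Fin (length B)) → Fin (length (lookup B i)) → Vtx B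
  dumV : Vtx B
  dumW : Vtx B

rotate : ℕ → Cycle → Cycle
rotate j c = drop j c ++ take j c

dropIdx : {A : Set} → ℕ → List A → List A
dropIdx _ [] = []
dropIdx zero (x ∷ xs) = xs
dropIdx (suc n) (x ∷ xs) = x ∷ dropIdx n xs

dropIdx2 : {A : Set} → ℕ → ℕ → List A → List A
dropIdx2 i i' xs = if i <ᵇ i' then dropIdx i (dropIdx i' xs) else dropIdx i' (dropIdx i xs)

-- C = C' case: cycle c (of length n; c = [] for a dummy vertex), v at
-- position a, w at position b, new label l.  Returns (Ĉ₁, Ĉ₂) where
-- Ĉ₁ = P ∪ {f}, P the path v₁ → w₂ (edges e_a … e_{b-1}) and
-- Ĉ₂ = P' ∪ {f'}, P' the path w₁ → v₂ (edges e_b … e_{a-1}).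
splitSame : Cycle → ℕ → ℕ → ℕ → Cycle × Cycle
splitSame c a b l =
  let r = rotate a c
      d = if a ≤ᵇ b then b ∸ a else (length c ∸ a) + b
  in (take d r ++ [ l ]) , (drop d r ++ [ l ])

-- C ≠ C' case: Ĉ = P ∪ P' ∪ {v₂→w₁, w₂→v₁}, P : v₁ → v₂ around c,
-- P' : w₁ → w₂ around c'.
splitDiff : Cycle → ℕ → Cycle → ℕ → ℕ → Cycle
splitDiff c a c' b l = rotate a c ++ [ l ] ++ rotate b c' ++ [ l ]

-- Result of splitting: either the C = C' case (D ∖ C, Ĉ₁, Ĉ₂) or the
-- C ≠ C' case ((D ∖ (C ∪ C')), Ĉ).
data Split : Set where
  same : Boundary → Cycle → Cycle → Split
  diff : Boundary → Cycle → Split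

split : (B : Boundary) → Vtx B → Vtx B → ℕ → Split
split B (real i a) (real i' b) l =
  if toℕ i ≡ᵇ toℕ i'
  then (let cs = splitSame (lookup B i) (toℕ a) (toℕ b) l
        in same (dropIdx (toℕ i) B) (proj₁ cs) (proj₂ cs))
  else diff (dropIdx2 (toℕ i) (toℕ i') B) (splitDiff (lookup B i) (toℕ a) (lookup B i') (toℕ b) l)
split B (real i a) dumV l = diff (dropIdx (toℕ i) B) (splitDiff (lookup B i) (toℕ a) [] 0 l)
split B (real i a) dumW l = diff (dropIdx (toℕ i) B) (splitDiff (lookup B i) (toℕ a) [] 0 l)
split B dumV (real i b) l = diff (dropIdx (toℕ i) B) (splitDiff [] 0 (lookup B i) (toℕ b) l)
split B dumW (real i b) l = diff (dropIdx (toℕ i) B) (splitDiff [] 0 (lookup B i) (toℕ b) l)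
split B dumV dumV l = let cs = splitSame [] 0 0 l in same B (proj₁ cs) (proj₂ cs)
split B dumW dumW l = let cs = splitSame [] 0 0 l in same B (proj₁ cs) (proj₂ cs)
split B dumV dumW l = diff B (splitDiff [] 0 [] 0 l)
split B dumW dumV l = diff B (splitDiff [] 0 [] 0 l)

-- Moves of restricted Cutter (D̄ = D_k ∖ C, ḡ = g_k), before checking the
-- no-repetition rule.  Move (a) only if g ≥ 1.
data CutterMove (s : State) (v w : Vtx (D s)) (l : ℕ) : State → Set where
  moveA : ∀ {R C₁ C₂ h} → split (D s) v w l ≡ same R C₁ C₂ → g s ≡ suc h →
          CutterMove s v w l (mkState (R ++ C₁ ∷ C₂ ∷ []) h)
  moveB : ∀ {R C₁ C₂} → split (D s) v w l ≡ same R C₁ C₂ →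
          CutterMove s v w l (mkState (R ++ [ C₁ ]) (g s))
  moveC : ∀ {R C₁ C₂} → split (D s) v w l ≡ same R C₁ C₂ →
          CutterMove s v w l (mkState (R ++ [ C₂ ]) (g s))
  moveD : ∀ {R C} → split (D s) v w l ≡ diff R C →
          CutterMove s v w l (mkState (R ++ [ C ]) (g s))

-- Reductions: contracting an edge deletes it from its cycle (a contracted
-- loop leaves an isolated vertex, which is deleted, so the cycle vanishes).

consNonEmpty : Cycle → Boundary → Boundary
consNonEmpty [] B = B
consNonEmpty (x ∷ c) B = (x ∷ c) ∷ B

data Contraction : Boundary → Boundary → Set where
  here  : ∀ {B} xs (x : ℕ) ys → Contraction ((xs ++ x ∷ ys) ∷ B) (consNonEmpty (xs ++ ys) B)
  there : ∀ {B B'} c → Contraction B B' → Contraction (c ∷ B) (c ∷ B')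

Reduction : State → State → Set
Reduction s s' = Star Contraction (D s) (D s') × g s' ≤ g s

-- Equivalence: isomorphic as labelled digraphs up to a bijective
-- relabelling, equal counters.
RotEq : Cycle → Cycle → Set
RotEq c c' = ∃₂ λ xs ys → c ≡ xs ++ ys × c' ≡ ys ++ xs

Iso : Boundary → Boundary → Set
Iso B B' = ∃ λ B'' → B ↭ B'' × Pointwise RotEq B'' B'

Equivalent : State → State → Set
Equivalent s s' =
  g s ≡ g s' ×
  Σ (ℕ → ℕ) λ σ → Injective _≡_ _≡_ σ × Iso (map (map σ) (D s)) (D s')

-- Marker strategies and plays against restricted Cutter.
-- A history is the list of earlier states (most recent first) together
-- with the current state; the turn number k is the length of the list
-- of earlier states, and the fresh label used at turn k is k itself
-- (labels 0, …, k-1 are exactly the previously used ones).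

Strategy : Set
Strategy = (past : List State) → (s : State) → Vtx (D s) × Vtx (D s)

Repeats : List State → State → Set
Repeats hist s' = Any (λ t → ∃ λ r → Reduction t r × Equivalent s' r) hist

data Reachable (σ : Strategy) (g₀ : ℕ) : List State → State → Set where
  start : Reachable σ g₀ [] (mkState [] g₀)
  step  : ∀ {past s s'} → Reachable σ g₀ past s →
          CutterMove s (proj₁ (σ past s)) (proj₂ (σ past s)) (length past) s' →
          ¬ Repeats (s ∷ past) s' →
          Reachable σ g₀ (s ∷ past) s'

{-# OPTIONS --safe #-}
module Submission where

open import Defs
open import Data.Bool using (Bool; true; false; if_then_else_; T; _∧_)
open import Data.Bool.ListAction using (all; any)
open import Data.Empty using (⊥)
open import Data.Fin using (Fin; zero; suc; toℕ; fromℕ<)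
open import Data.Fin.Properties using (toℕ<n; toℕ-fromℕ<; injective⇒≤; fromℕ<-injective) renaming (any? to finAny?)
open import Data.List using (List; []; _∷_; _++_; [_]; length; lookup; take; drop; concat; map; upTo)
open import Data.List.Membership.Propositional using (_∈_; _∉_; find; lose)
open import Data.List.Membership.Propositional.Properties
  using (∈-++⁺ˡ; ∈-++⁺ʳ; ∈-++⁻; ∈-concat⁺′; ∈-deduplicate⁻; ∈-lookup; ∈-map⁺; ∈-upTo⁺)
open import Data.List.Properties
  using (++-assoc; ++-conicalˡ; ++-identityʳ; concat-++; length-++; length-++-comm; map-++; map-cong-local; map-id-local; take++drop≡id)
open import Data.List.Relation.Binary.Permutation.Homogeneous as Perm using (Permutation)
open import Data.List.Relation.Binary.Permutation.Propositional as P using (_↭_)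
open import Data.List.Relation.Binary.Permutation.Propositional.Properties using (++-comm; ++⁺ˡ; ++⁺ʳ; shifts)
open import Data.List.Relation.Binary.Pointwise as Pw using (Pointwise; []; _∷_)
open import Data.List.Relation.Binary.Sublist.Propositional as Sub using (_⊆_; []; _∷_; _∷ʳ_; ⊆-refl; from∈)
import Data.List.Relation.Binary.Sublist.Propositional.Properties as Subₚ
open import Data.List.Relation.Unary.All as All using (All; []; _∷_)
open import Data.List.Relation.Unary.All.Properties using (all-upTo; all⁺; concat⁺; take⁺; drop⁺)
  renaming (++⁺ to All-++⁺; ++⁻ˡ to All-++⁻ˡ; ++⁻ʳ to All-++⁻ʳ)
open import Data.List.Relation.Unary.AllPairs using ([]; _∷_)
open import Data.List.Relation.Unary.Any as Any using (Any; here; there; any?)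
open import Data.List.Relation.Unary.Any.Properties using (any⁻)
open import Data.List.Relation.Unary.Unique.Propositional using (Unique)
open import Data.Nat using (ℕ; zero; suc; pred; _+_; _*_; _∸_; _≤_; _<_; z≤n; s≤s; _≤ᵇ_; _<ᵇ_; _≡ᵇ_)
open import Data.Nat.DivMod using (_/_; _%_; m/n*n≤m; m≡m%n+[m/n]*n; m%n<n)
open import Data.Nat.Properties
open import Data.Nat.Tactic.RingSolver using (solve-∀)
open import Data.List.Membership.DecPropositional _≟_ using (_∈?_)
open import Data.List.Relation.Unary.Unique.DecPropositional.Properties _≟_ using (deduplicate-!)
open import Data.Product using (Σ; ∃; ∃₂; _×_; _,_; proj₁; proj₂)
open import Data.Sum using (_⊎_; inj₁; inj₂)
open import Data.Unit using (⊤; tt)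
open import Function using (_∘_)
open import Function.Definitions using (Injective)
open import Relation.Binary.Construct.Closure.ReflexiveTransitive using (Star; ε; _◅_; gmap)
open import Relation.Binary.PropositionalEquality
  using (_≡_; _≢_; refl; sym; trans; cong; cong₂; subst; subst₂; module ≡-Reasoning)
open import Relation.Nullary using (¬_; Dec; yes; no; contradiction)
open import Relation.Nullary.Decidable using (_×-dec_; _⊎-dec_; ¬?; map′)

-- Call a label private to an arc of a cut if it occurs nowhere else. Keeping
-- only the other arc would then yield a relabelled contraction of the current
-- position, so restricted Cutter never loses a label: the value is at most the
-- number of moves, and if both arcs carry private labels then Cutter has to
-- answer (a). As (a) is available at most g₀ times, it suffices to bound the
-- number b of moves (b), (c), (d).
--
-- Marker does so by keeping c + g ≤ 3 b, where g is the counter and the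
-- allowance c depends on the shape of the position. A typical shape is a pair
-- of cycles u s and v s, with c = 3. Joining them costs one from b and gives
-- u s k v s k; cutting this between u and v forces (a) and gives a rung, two
-- cycles sharing three labels and ending with u and v, with c = 1. Marker now
-- tries to cut off u, and then v. If Cutter answers (a) twice, the cut-off
-- cycles can be joined to a further rung on top of the first, at no net loss.
-- If Cutter instead answers (b), one is lost from b, but labels of the rung
-- become private and three or four cuts answered by (a) follow. After one
-- answer (a) and one answer (b) a tree of cycles remains, which Marker cuts up
-- later; on the way down the ladder this also leaves spare pairs u s, v s. Once
-- there are b - 1 spare pairs Marker uses only those. From the empty position
-- the allowance is 8, so b = ⌊(g₀ + 10) / 3⌋ and 3 (b + g₀) ≤ 4 g₀ + 10.

-- Rotations

rot¹ : Cycle → Cycle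
rot¹ []       = []
rot¹ (x ∷ xs) = xs ++ [ x ]

rotⁿ : ℕ → Cycle → Cycle
rotⁿ zero    c = c
rotⁿ (suc n) c = rotⁿ n (rot¹ c)

rotⁿ-++ : ∀ xs ys → rotⁿ (length xs) (xs ++ ys) ≡ ys ++ xs
rotⁿ-++ []       ys = sym (++-identityʳ ys)
rotⁿ-++ (x ∷ xs) ys = trans (cong (rotⁿ (length xs)) (++-assoc xs ys [ x ]))
  (trans (rotⁿ-++ xs (ys ++ [ x ])) (++-assoc ys [ x ] xs))

rot-refl : ∀ {c} → RotEq c c
rot-refl {c} = [] , c , refl , sym (++-identityʳ c)

rot-sym : ∀ {c d} → RotEq c d → RotEq d c
rot-sym (xs , ys , p , q) = ys , xs , q , p

rot¹-step : ∀ {c d} → RotEq c d → RotEq c (rot¹ d)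
rot¹-step (xs , y ∷ ys , refl , refl) =
  xs ++ [ y ] , ys , sym (++-assoc xs [ y ] ys) , ++-assoc ys xs [ y ]
rot¹-step ([] , [] , refl , refl) = [] , [] , refl , refl
rot¹-step (x ∷ xs , [] , refl , refl) = [ x ] , xs , cong (x ∷_) (++-identityʳ xs) , refl

rotⁿ-rot : ∀ n {c d} → RotEq c d → RotEq c (rotⁿ n d)
rotⁿ-rot zero    r = r
rotⁿ-rot (suc n) r = rotⁿ-rot n (rot¹-step r)

-- Comparing two decompositions of the middle list would need cases on how they overlap. Instead the
-- second rotation is carried out one edge at a time, and each such step preserves the relation.
rot-trans : ∀ {c d e} → RotEq c d → RotEq d e → RotEq c e
rot-trans r (xs , ys , refl , refl) =
  subst (RotEq _) (rotⁿ-++ xs ys) (rotⁿ-rot (length xs) r)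

rot-≡ : ∀ {c d} → c ≡ d → RotEq c d
rot-≡ refl = rot-refl

rot-∈ : ∀ {c d x} → RotEq c d → x ∈ c → x ∈ d
rot-∈ (xs , ys , refl , refl) x∈ with ∈-++⁻ xs x∈
... | inj₁ p = ∈-++⁺ʳ ys p
... | inj₂ p = ∈-++⁺ˡ p

-- Boundaries up to isomorphism fixing the labels

infix 4 _≈_
_≈_ : Boundary → Boundary → Set
_≈_ = Permutation RotEq

≈-refl : ∀ {D} → D ≈ D
≈-refl = Perm.refl (Pw.refl rot-refl)

≈-sym : ∀ {D E} → D ≈ E → E ≈ D
≈-sym = Perm.sym rot-sym

≈-trans : ∀ {D E F} → D ≈ E → E ≈ F → D ≈ F
≈-trans = Perm.trans

↭⇒≈ : ∀ {D E} → D ↭ E → D ≈ E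
↭⇒≈ P.refl          = ≈-refl
↭⇒≈ (P.prep x p)    = Perm.prep rot-refl (↭⇒≈ p)
↭⇒≈ (P.swap x y p)  = Perm.swap rot-refl rot-refl (↭⇒≈ p)
↭⇒≈ (P.trans p q)   = Perm.trans (↭⇒≈ p) (↭⇒≈ q)

pw-∈ : ∀ {D E x} → Pointwise RotEq D E → x ∈ concat D → x ∈ concat E
pw-∈ (_∷_ {x = c} {y = d} r rs) x∈ with ∈-++⁻ c x∈
... | inj₁ p = ∈-++⁺ˡ (rot-∈ r p)
... | inj₂ p = ∈-++⁺ʳ d (pw-∈ rs p)

≈-∈ : ∀ {D E x} → D ≈ E → x ∈ concat D → x ∈ concat E
≈-∈ (Perm.refl rs) x∈ = pw-∈ rs x∈
≈-∈ (Perm.prep {x = c} {d} r p) x∈ with ∈-++⁻ c x∈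
... | inj₁ q = ∈-++⁺ˡ (rot-∈ r q)
... | inj₂ q = ∈-++⁺ʳ d (≈-∈ p q)
≈-∈ (Perm.swap {x = c} {y = d} {x′ = c'} {y′ = d'} r s p) x∈ with ∈-++⁻ c x∈
... | inj₁ q = ∈-++⁺ʳ d' (∈-++⁺ˡ (rot-∈ r q))
... | inj₂ q with ∈-++⁻ d q
...   | inj₁ q' = ∈-++⁺ˡ (rot-∈ s q')
...   | inj₂ q' = ∈-++⁺ʳ d' (∈-++⁺ʳ c' (≈-∈ p q'))
≈-∈ (Perm.trans p q) x∈ = ≈-∈ q (≈-∈ p x∈)

snoc-≈ : ∀ {R R'} c → R ≈ R' → (R ++ [ c ]) ≈ (c ∷ R')
snoc-≈ {R} c p = ≈-trans (↭⇒≈ (++-comm R [ c ])) (Perm.prep rot-refl p)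

snoc₂-≈ : ∀ {R R'} c d → R ≈ R' → (R ++ c ∷ d ∷ []) ≈ (c ∷ d ∷ R')
snoc₂-≈ {R} c d p = ≈-trans (↭⇒≈ (++-comm R (c ∷ d ∷ []))) (Perm.prep rot-refl (Perm.prep rot-refl p))

-- The game up to isomorphism, without the no-repetition rule

Private : ℕ → Cycle → Boundary → Set
Private k Q D = ∃ λ x → x ∈ Q × x ≢ k × x ∉ concat D

-- From boundary D with counter g and new label k, Marker can bound the number
-- of further moves of type (b), (c), (d) by b. Cutter is only spared keeping
-- one arc of a cut when that would lose a private label of the other arc.
data AWins : (k b g : ℕ) → Boundary → Set where
  cut : ∀ {k b g D} P Q R → Q ≢ [] → D ≈ (P ++ Q) ∷ R →
    (∀ {h} → g ≡ suc h → AWins (suc k) b h ((P ++ [ k ]) ∷ (Q ++ [ k ]) ∷ R)) →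
    (Private k Q (P ∷ R) ⊎ ∃ λ b' → b ≡ suc b' × AWins (suc k) b' g ((P ++ [ k ]) ∷ R)) →
    (Private k P (Q ∷ R) ⊎ ∃ λ b' → b ≡ suc b' × AWins (suc k) b' g ((Q ++ [ k ]) ∷ R)) →
    AWins k b g D
  join : ∀ {k b g D} C C' R → C ≢ [] → C' ≢ [] → D ≈ C ∷ C' ∷ R →
    AWins (suc k) b g ((C ++ [ k ] ++ C' ++ [ k ]) ∷ R) →
    AWins k (suc b) g D
  dummy : ∀ {k b g D} →
    (∀ {h} → g ≡ suc h → AWins (suc k) (suc b) h ([ k ] ∷ [ k ] ∷ D)) →
    AWins (suc k) b g ([ k ] ∷ D) →
    AWins k (suc b) g D

AWins-≈ : ∀ {k b g D E} → D ≈ E → AWins k b g E → AWins k b g D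
AWins-≈ p (cut P Q R n q a b c) = cut P Q R n (≈-trans p q) a b c
AWins-≈ p (join C C' R n m q a) = join C C' R n m (≈-trans p q) a
AWins-≈ p (dummy a b) = dummy (λ e → AWins-≈ (Perm.prep rot-refl (Perm.prep rot-refl p)) (a e))
                              (AWins-≈ (Perm.prep rot-refl p) b)

-- Locating cycles of a boundary

data Pick : Boundary → Cycle → Boundary → Set where
  here  : ∀ {c D} → Pick (c ∷ D) c D
  there : ∀ {c d D D'} → Pick D d D' → Pick (c ∷ D) d (c ∷ D')

pick-pw : ∀ {D E c E'} → Pointwise RotEq D E → Pick E c E' →
  ∃₂ λ d D' → Pick D d D' × RotEq d c × Pointwise RotEq D' E'
pick-pw (r ∷ rs) here = _ , _ , here , r , rs
pick-pw (r ∷ rs) (there p) with pick-pw rs p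
... | d , D' , q , s , t = d , _ , there q , s , r ∷ t

-- Lets a move planned on a convenient representative `E` be played on the actual position `D`.
pick-≈ : ∀ {D E c E'} → D ≈ E → Pick E c E' → ∃₂ λ d D' → Pick D d D' × RotEq d c × D' ≈ E'
pick-≈ (Perm.refl rs) p with pick-pw rs p
... | d , D' , q , s , t = d , D' , q , s , Perm.refl t
pick-≈ (Perm.prep r p) here = _ , _ , here , r , p
pick-≈ (Perm.prep r p) (there q) with pick-≈ p q
... | d , D' , q' , s , t = d , _ , there q' , s , Perm.prep r t
pick-≈ (Perm.swap r s p) here = _ , _ , there here , s , Perm.prep r p
pick-≈ (Perm.swap r s p) (there here) = _ , _ , here , r , Perm.prep s p
pick-≈ (Perm.swap r s p) (there (there q)) with pick-≈ p q
... | d , D' , q' , u , t = d , _ , there (there q') , u , Perm.swap r s t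
pick-≈ (Perm.trans p q) r with pick-≈ q r
... | d , D' , r' , s , t with pick-≈ p r'
...   | e , D'' , r'' , s' , t' = e , D'' , r'' , rot-trans s' s , ≈-trans t' t

pick-index : ∀ {D c D'} → Pick D c D' →
  ∃ λ (i : Fin (length D)) → lookup D i ≡ c × dropIdx (toℕ i) D ≡ D'
pick-index here = zero , refl , refl
pick-index (there p) with pick-index p
... | i , refl , refl = suc i , refl , refl

if-∷ : ∀ {A : Set} (t : Bool) (x : A) (xs ys : List A) → (if t then x ∷ xs else x ∷ ys) ≡ x ∷ (if t then xs else ys)
if-∷ true  x xs ys = refl
if-∷ false x xs ys = refl

-- `dropIdx2` removes the larger index first, so both indices refer to the original list although
-- the second pick is made in what the first one leaves.
pick₂-index : ∀ {D c D' d D''} → Pick D c D' → Pick D' d D'' →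
  ∃₂ λ (i j : Fin (length D)) → lookup D i ≡ c × lookup D j ≡ d ×
    (toℕ i ≡ᵇ toℕ j) ≡ false × dropIdx2 (toℕ i) (toℕ j) D ≡ D''
pick₂-index here q with pick-index q
... | j , refl , refl = zero , suc j , refl , refl , refl , refl
pick₂-index (there p) here with pick-index p
... | i , refl , refl = suc i , zero , refl , refl , refl , refl
pick₂-index {D = c ∷ D} (there p) (there q) with pick₂-index p q
... | i , j , refl , refl , ne , refl = suc i , suc j , refl , refl , ne , if-∷ (toℕ i <ᵇ toℕ j) c _ _

-- The game with vertices, without the no-repetition rule

Lost : Boundary → Boundary → Set
Lost D D' = Any (_∉ concat D') (concat D)

Response : (State → Set) → Boundary → ℕ → Split → Set
Response W D g       (diff R C)    = W (mkState (R ++ [ C ]) g)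
Response W D zero    (same R C C') =
  (Lost D (R ++ [ C ]) ⊎ W (mkState (R ++ [ C ]) zero)) ×
  (Lost D (R ++ [ C' ]) ⊎ W (mkState (R ++ [ C' ]) zero))
Response W D (suc h) (same R C C') = W (mkState (R ++ C ∷ C' ∷ []) h) ×
  (Lost D (R ++ [ C ]) ⊎ W (mkState (R ++ [ C ]) (suc h))) ×
  (Lost D (R ++ [ C' ]) ⊎ W (mkState (R ++ [ C' ]) (suc h)))

-- From s with new label k, Marker ends the game in fewer than n moves. Keeping
-- one arc at the cost of a label is not answered: it repeats a position.
Wins : ℕ → ℕ → State → Set
Wins zero    k s = ⊥
Wins (suc n) k s = ∃₂ λ v w → Response (Wins n (suc k)) (D s) (g s) (split (D s) v w k)

Lost? : ∀ D D' → Dec (Lost D D')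
Lost? D D' = any? (λ x → ¬? (x ∈? concat D')) (concat D)

Response? : ∀ {W} → (∀ s → Dec (W s)) → ∀ D g c → Dec (Response W D g c)
Response? W? D g       (diff R C)    = W? _
Response? W? D zero    (same R C C') =
  (Lost? D (R ++ [ C ]) ⊎-dec W? _) ×-dec (Lost? D (R ++ [ C' ]) ⊎-dec W? _)
Response? W? D (suc h) (same R C C') =
  W? _ ×-dec ((Lost? D (R ++ [ C ]) ⊎-dec W? _) ×-dec (Lost? D (R ++ [ C' ]) ⊎-dec W? _))

vtx-any? : ∀ {B} {Q : Vtx B → Set} → (∀ v → Dec (Q v)) → Dec (∃ Q)
vtx-any? {B} {Q} Q? = map′ to from
  (finAny? (λ i → finAny? (λ a → Q? (real i a))) ⊎-dec (Q? dumV ⊎-dec Q? dumW))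
  where
  to : (∃ λ i → ∃ λ a → Q (real i a)) ⊎ Q dumV ⊎ Q dumW → ∃ Q
  to (inj₁ (i , a , q)) = _ , q
  to (inj₂ (inj₁ q))    = _ , q
  to (inj₂ (inj₂ q))    = _ , q
  from : ∃ Q → (∃ λ i → ∃ λ a → Q (real i a)) ⊎ Q dumV ⊎ Q dumW
  from (real i a , q) = inj₁ (i , a , q)
  from (dumV , q)     = inj₂ (inj₁ q)
  from (dumW , q)     = inj₂ (inj₂ q)

Wins? : ∀ n k s → Dec (Wins n k s)
Wins? zero    k s = no λ ()
Wins? (suc n) k s = vtx-any? λ v → vtx-any? λ w → Response? (Wins? n (suc k)) (D s) (g s) (split (D s) v w k)

-- From abstract to concrete wins

drop-length-++ : ∀ {A : Set} (xs ys : List A) → drop (length xs) (xs ++ ys) ≡ ys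
drop-length-++ []       ys = refl
drop-length-++ (x ∷ xs) ys = drop-length-++ xs ys

take-length-++ : ∀ {A : Set} (xs ys : List A) → take (length xs) (xs ++ ys) ≡ xs
take-length-++ []       ys = refl
take-length-++ (x ∷ xs) ys = cong (x ∷_) (take-length-++ xs ys)

rotate-length : ∀ xs ys → rotate (length xs) (xs ++ ys) ≡ ys ++ xs
rotate-length xs ys = cong₂ _++_ (drop-length-++ xs ys) (take-length-++ xs ys)

nonempty-length : ∀ {A : Set} {c : List A} → c ≢ [] → 0 < length c
nonempty-length {c = []}    n = contradiction refl n
nonempty-length {c = _ ∷ _} n = s≤s z≤n

rot-index : ∀ {c r} → r ≢ [] → RotEq c r → ∃ λ (a : Fin (length c)) → rotate (toℕ a) c ≡ r
-- For a full rotation the offset `length xs` would lie one past the last vertex, so vertex 0 is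
-- taken.
rot-index {c} {r} n (xs , [] , refl , refl) = fromℕ< 0< , eq
  where
  0< : 0 < length (xs ++ [])
  0< = nonempty-length (n ∘ trans (sym (++-identityʳ xs)))
  eq : rotate (toℕ (fromℕ< 0<)) (xs ++ []) ≡ xs
  eq rewrite toℕ-fromℕ< 0< = trans (++-identityʳ (xs ++ [])) (++-identityʳ xs)
rot-index {c} {r} n (xs , y ∷ ys , refl , refl) = fromℕ< a< , eq
  where
  a< : length xs < length (xs ++ y ∷ ys)
  a< rewrite length-++ xs {y ∷ ys} | +-suc (length xs) (length ys) = s≤s (m≤m+n _ _)
  eq : rotate (toℕ (fromℕ< a<)) (xs ++ y ∷ ys) ≡ (y ∷ ys) ++ xs
  eq rewrite toℕ-fromℕ< a< = rotate-length xs (y ∷ ys)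

≤ᵇ-true : ∀ {m n} → m ≤ n → (m ≤ᵇ n) ≡ true
≤ᵇ-true {m} {n} p with m ≤ᵇ n in e | ≤⇒≤ᵇ p
... | true | _ = refl

≤ᵇ-false : ∀ {m n} → n < m → (m ≤ᵇ n) ≡ false
≤ᵇ-false {m} {n} p with m ≤ᵇ n in e
... | false = refl
... | true  = contradiction (≤ᵇ⇒≤ m n (subst T (sym e) tt)) (<⇒≱ p)

-- The end vertex is `a + p` modulo `n`. Full length `p = n` is unattainable, since equal end
-- vertices give the empty arc; hence the condition `Q ≢ []` in `cut`.
arc-end : ∀ {n a p} → a < n → p < n → ∃ λ (b : Fin n) →
  (if a ≤ᵇ toℕ b then toℕ b ∸ a else (n ∸ a) + toℕ b) ≡ p
arc-end {n} {a} {p} a<n p<n with a + p <? n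
... | yes q = fromℕ< q , eq
  where
  eq : (if a ≤ᵇ toℕ (fromℕ< q) then toℕ (fromℕ< q) ∸ a else (n ∸ a) + toℕ (fromℕ< q)) ≡ p
  eq rewrite toℕ-fromℕ< q | ≤ᵇ-true (m≤m+n a p) = m+n∸m≡n a p
... | no q = fromℕ< b<n , eq
  where
  b<a : a + p ∸ n < a
  b<a = +-cancelʳ-< n _ _ (subst (_< a + n) (sym (m∸n+n≡m (≮⇒≥ q))) (+-monoʳ-< a p<n))
  b<n : a + p ∸ n < n
  b<n = <-trans b<a a<n
  eq : (if a ≤ᵇ toℕ (fromℕ< b<n) then toℕ (fromℕ< b<n) ∸ a else (n ∸ a) + toℕ (fromℕ< b<n)) ≡ p
  eq rewrite toℕ-fromℕ< b<n | ≤ᵇ-false b<a = +-cancelˡ-≡ a _ _ (begin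
    a + (n ∸ a + (a + p ∸ n))   ≡⟨ +-assoc a (n ∸ a) _ ⟨
    a + (n ∸ a) + (a + p ∸ n)   ≡⟨ cong (_+ (a + p ∸ n)) (m+[n∸m]≡n (<⇒≤ a<n)) ⟩
    n + (a + p ∸ n)             ≡⟨ m+[n∸m]≡n (≮⇒≥ q) ⟩
    a + p                       ∎)
    where open ≡-Reasoning

≡ᵇ-refl : ∀ n → (n ≡ᵇ n) ≡ true
≡ᵇ-refl zero    = refl
≡ᵇ-refl (suc n) = ≡ᵇ-refl n

++-≢[] : ∀ {A : Set} (xs : List A) {ys} → ys ≢ [] → xs ++ ys ≢ []
++-≢[] []       n e = n e
++-≢[] (x ∷ xs) n ()

rot-length : ∀ {c d} → RotEq c d → length c ≡ length d
rot-length (xs , ys , refl , refl) = length-++-comm xs ys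

splitSame-arc : ∀ {c a b k P Q} → rotate a c ≡ P ++ Q →
  (if a ≤ᵇ b then b ∸ a else (length c ∸ a) + b) ≡ length P →
  splitSame c a b k ≡ (P ++ [ k ] , Q ++ [ k ])
splitSame-arc {P = P} {Q} e e' rewrite e' | e | take-length-++ P Q | drop-length-++ P Q = refl

split-same : ∀ D i (a b : Fin (length (lookup D i))) {k P Q} → rotate (toℕ a) (lookup D i) ≡ P ++ Q →
  (if toℕ a ≤ᵇ toℕ b then toℕ b ∸ toℕ a else (length (lookup D i) ∸ toℕ a) + toℕ b) ≡ length P →
  split D (real i a) (real i b) k ≡ same (dropIdx (toℕ i) D) (P ++ [ k ]) (Q ++ [ k ])
split-same D i a b {k} e e' rewrite ≡ᵇ-refl (toℕ i) =
  cong (λ p → same (dropIdx (toℕ i) D) (proj₁ p) (proj₂ p)) (splitSame-arc {a = toℕ a} e e')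

split-diff : ∀ D i j (a : Fin (length (lookup D i))) (b : Fin (length (lookup D j))) {k C C'} →
  (toℕ i ≡ᵇ toℕ j) ≡ false → rotate (toℕ a) (lookup D i) ≡ C → rotate (toℕ b) (lookup D j) ≡ C' →
  split D (real i a) (real j b) k ≡ diff (dropIdx2 (toℕ i) (toℕ j) D) (C ++ [ k ] ++ C' ++ [ k ])
split-diff D i j a b ne refl refl rewrite ne = refl

cut-vertices : ∀ {D R} P Q k → Q ≢ [] → D ≈ (P ++ Q) ∷ R →
  ∃₂ λ v w → ∃ λ R' → split D v w k ≡ same R' (P ++ [ k ]) (Q ++ [ k ]) × R' ≈ R
cut-vertices {D} P Q k n p with pick-≈ p here
... | d , R' , q , s , t with pick-index q
...   | i , refl , refl with rot-index (++-≢[] P n) s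
...     | a , e with arc-end (toℕ<n a) p<
  where
  p< : length P < length d
  p< rewrite rot-length s | length-++ P {Q} = m<m+n (length P) (nonempty-length n)
...       | b , e' = real i a , real i b , _ , split-same D i a b e e' , t

join-vertices : ∀ {D C C' R} k → C ≢ [] → C' ≢ [] → D ≈ C ∷ C' ∷ R →
  ∃₂ λ v w → ∃ λ R' → split D v w k ≡ diff R' (C ++ [ k ] ++ C' ++ [ k ]) × R' ≈ R
join-vertices {D} k n n' p with pick-≈ p here
... | d , R₁ , q , s , t with pick-≈ t here
...   | d' , R₂ , q' , s' , t' with pick₂-index q q'
...     | i , j , refl , refl , ne , refl with rot-index n s | rot-index n' s'
...       | a , e | b , e' = real i a , real j b , _ , split-diff D i j a b ne e e' , t'

private⇒lost : ∀ {k D Q R C R'} → D ≈ C ∷ R → Q ⊆ C → R' ≈ R → (P : Cycle) → Private k Q (P ∷ R) →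
  Lost D (R' ++ [ P ++ [ k ] ])
private⇒lost {k} {D} {Q} {R} {C} {R'} p Q⊆C q P (x , x∈ , x≢k , x∉) =
  lose (≈-∈ (≈-sym p) (∈-++⁺ˡ (Sub.lookup Q⊆C x∈)))
       (λ y → bad (≈-∈ (snoc-≈ (P ++ [ k ]) q) y))
  where
  bad : ¬ (x ∈ concat ((P ++ [ k ]) ∷ R))
  bad y with ∈-++⁻ (P ++ [ k ]) y
  ... | inj₂ z = x∉ (∈-++⁺ʳ P z)
  ... | inj₁ z with ∈-++⁻ P z
  ...   | inj₁ u = x∉ (∈-++⁺ˡ u)
  ...   | inj₂ (here u) = x≢k u

Wins-suc : ∀ b h {k s} → Wins (suc (b + h)) k s → Wins (b + suc h) k s
Wins-suc b h {k} {s} = subst (λ n → Wins n k s) (sym (+-suc b h))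

-- Every answered move lowers `b + g` by one: (a) lowers `g`, and (b), (c), (d) lower `b`. The
-- successor is there because `Wins` counts strictly.
AWins⇒Wins : ∀ {k b g D} → AWins k b g D → Wins (suc (b + g)) k (mkState D g)

answer : ∀ {k b} g {D P Q R R'} → D ≈ (P ++ Q) ∷ R → R' ≈ R →
  (∀ {h} → g ≡ suc h → AWins (suc k) b h ((P ++ [ k ]) ∷ (Q ++ [ k ]) ∷ R)) →
  (Private k Q (P ∷ R) ⊎ ∃ λ b' → b ≡ suc b' × AWins (suc k) b' g ((P ++ [ k ]) ∷ R)) →
  (Private k P (Q ∷ R) ⊎ ∃ λ b' → b ≡ suc b' × AWins (suc k) b' g ((Q ++ [ k ]) ∷ R)) →
  Response (Wins (b + g) (suc k)) D g (same R' (P ++ [ k ]) (Q ++ [ k ]))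

keep : ∀ {k b g D S C P Q R R'} → D ≈ C ∷ R → R' ≈ R → Q ⊆ C → S ≡ P ++ [ k ] →
  (Private k Q (P ∷ R) ⊎ ∃ λ b' → b ≡ suc b' × AWins (suc k) b' g (S ∷ R)) →
  Lost D (R' ++ [ S ]) ⊎ Wins (b + g) (suc k) (mkState (R' ++ [ S ]) g)
keep {P = P} p q Q⊆C refl (inj₁ x)               = inj₁ (private⇒lost p Q⊆C q P x)
keep         p q Q⊆C refl (inj₂ (b' , refl , w)) = inj₂ (AWins⇒Wins (AWins-≈ (snoc-≈ _ q) w))

answer zero {P = P} {Q} p q a b c =
  keep p q (Subₚ.++⁺ˡ P ⊆-refl) refl b , keep p q (Subₚ.++⁺ʳ Q ⊆-refl) refl c
answer {b = n} (suc h) {P = P} {Q} p q a b c =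
  Wins-suc n h (AWins⇒Wins (AWins-≈ (snoc₂-≈ _ _ q) (a refl))) ,
  keep p q (Subₚ.++⁺ˡ P ⊆-refl) refl b , keep p q (Subₚ.++⁺ʳ Q ⊆-refl) refl c

AWins⇒Wins {k} {b} {g} (cut P Q R n p a b₁ c₁) with cut-vertices P Q k n p
... | v , w , R' , e , q = v , w , subst (Response _ _ _) (sym e) (answer g p q a b₁ c₁)
AWins⇒Wins {k} (join C C' R n n' p a) with join-vertices k n n' p
... | v , w , R' , e , q = v , w , subst (Response _ _ _) (sym e) (AWins⇒Wins (AWins-≈ (snoc-≈ _ q) a))
AWins⇒Wins {k} {suc b} {zero} (dummy a c) = dumV , dumV , inj₂ w , inj₂ w
  where w = AWins⇒Wins (AWins-≈ (snoc-≈ _ ≈-refl) c)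
AWins⇒Wins {k} {suc b} {suc h} (dummy a c) =
  dumV , dumV , Wins-suc (suc b) h (AWins⇒Wins (AWins-≈ (snoc₂-≈ _ _ ≈-refl) (a refl))) , inj₂ w , inj₂ w
  where w = AWins⇒Wins (AWins-≈ (snoc-≈ _ ≈-refl) c)

-- Moves that lose a label repeat a position

-- Edges outside the sublist are contracted from left to right, with the kept ones collected in
-- `pre`. As the final cycle is nonempty, no intermediate cycle vanishes.
contract-cycle : ∀ {B c c'} pre → c' ⊆ c → pre ++ c' ≢ [] →
  Star Contraction ((pre ++ c) ∷ B) ((pre ++ c') ∷ B)
contract-cycle pre [] n = ε
contract-cycle {B} {y ∷ c} {c'} pre (.y ∷ʳ p) n =
  subst (Contraction _) (cons-≢[] ne) (here pre y c) ◅ contract-cycle pre p n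
  where
  cons-≢[] : ∀ {d} → d ≢ [] → consNonEmpty d B ≡ d ∷ B
  cons-≢[] {[]}    n = contradiction refl n
  cons-≢[] {_ ∷ _} n = refl
  ⊆-[] : ∀ {d : Cycle} → d ⊆ [] → d ≡ []
  ⊆-[] [] = refl
  ne : pre ++ c ≢ []
  ne e with refl ← ++-conicalˡ pre c e | refl ← e = n (⊆-[] p)
contract-cycle {B} {x ∷ c} {x ∷ c'} pre (refl ∷ p) n =
  subst₂ (λ a b → Star Contraction (a ∷ B) (b ∷ B)) (++-assoc pre [ x ] c) (++-assoc pre [ x ] c')
    (contract-cycle (pre ++ [ x ]) p (subst (_≢ []) (sym (++-assoc pre [ x ] c')) n))

replace : (D : Boundary) → Fin (length D) → Cycle → Boundary
replace (c ∷ D) zero    d = d ∷ D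
replace (c ∷ D) (suc i) d = c ∷ replace D i d

contract-at : ∀ D i {c'} → c' ⊆ lookup D i → c' ≢ [] → Star Contraction D (replace D i c')
contract-at (c ∷ D) zero    p n = contract-cycle [] p n
contract-at (c ∷ D) (suc i) p n = gmap (c ∷_) (there c) (contract-at D i p n)

replace-↭ : ∀ D i c → dropIdx (toℕ i) D ++ [ c ] ↭ replace D i c
replace-↭ (d ∷ D) zero    c = ++-comm D [ c ]
replace-↭ (d ∷ D) (suc i) c = P.prep d (replace-↭ D i c)

replace-rot : ∀ D i {c d} → RotEq c d → Pointwise RotEq (replace D i c) (replace D i d)
replace-rot (e ∷ D) zero    r = r ∷ Pw.refl rot-refl
replace-rot (e ∷ D) (suc i) r = rot-refl ∷ replace-rot D i r

⊆-++-split : ∀ {zs : Cycle} xs {ys} → zs ⊆ xs ++ ys → ∃₂ λ us vs → zs ≡ us ++ vs × us ⊆ xs × vs ⊆ ys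
⊆-++-split [] p = [] , _ , refl , [] , p
⊆-++-split (x ∷ xs) (.x ∷ʳ p) with ⊆-++-split xs p
... | us , vs , e , q , r = us , vs , e , x ∷ʳ q , r
⊆-++-split (x ∷ xs) (refl ∷ p) with ⊆-++-split xs p
... | us , vs , refl , q , r = x ∷ us , vs , refl , refl ∷ q , r

⊆-rot : ∀ {c d e} → RotEq c d → e ⊆ d → ∃ λ e' → e' ⊆ c × RotEq e e'
⊆-rot (xs , ys , refl , refl) p with ⊆-++-split ys p
... | us , vs , refl , q , r = vs ++ us , Subₚ.++⁺ r q , us , vs , refl , refl

-- Equivalence asks for an injective relabelling of all naturals, hence a swap instead of a
-- substitution.
transpose : ℕ → ℕ → ℕ → ℕ
transpose a b x with x ≟ a | x ≟ b
... | yes _ | _     = b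
... | no _  | yes _ = a
... | no _  | no _  = x

transpose-left : ∀ a b → transpose a b a ≡ b
transpose-left a b with a ≟ a
... | yes _ = refl
... | no n  = contradiction refl n

transpose-other : ∀ {a b x} → x ≢ a → x ≢ b → transpose a b x ≡ x
transpose-other {a} {b} {x} p q with x ≟ a | x ≟ b
... | yes r | _     = contradiction r p
... | no _  | yes r = contradiction r q
... | no _  | no _  = refl

transpose-involutive : ∀ a b x → transpose a b (transpose a b x) ≡ x
transpose-involutive a b x with x ≟ a | x ≟ b
... | yes refl | _ with b ≟ a | b ≟ b
...   | yes p | _     = p
...   | no _  | yes _ = refl
...   | no _  | no n  = contradiction refl n
transpose-involutive a b x | no n | yes refl with a ≟ a
...   | yes _ = refl
...   | no m  = contradiction refl m
transpose-involutive a b x | no n | no m = transpose-other n m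

transpose-injective : ∀ a b → Injective _≡_ _≡_ (transpose a b)
transpose-injective a b {x} {y} e =
  trans (sym (transpose-involutive a b x)) (trans (cong (transpose a b) e) (transpose-involutive a b y))

map-fix : ∀ {σ : ℕ → ℕ} {w} → (∀ {x} → x ∈ w → σ x ≡ x) → map σ w ≡ w
map-fix f = map-id-local (All.tabulate f)

map²-fix : ∀ {σ : ℕ → ℕ} {D} → (∀ {x} → x ∈ concat D → σ x ≡ x) → map (map σ) D ≡ D
map²-fix {D = []}    f = refl
map²-fix {D = c ∷ D} f = cong₂ _∷_ (map-fix (f ∘ ∈-++⁺ˡ)) (map²-fix {D = D} (f ∘ ∈-++⁺ʳ c))

concat-∈ : ∀ {D : Boundary} {c x} → c ∈ D → x ∈ c → x ∈ concat D
concat-∈ p q = ∈-concat⁺′ q p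

dropIdx-∈ : ∀ (D : Boundary) i {x} → x ∈ concat (dropIdx i D) → x ∈ concat D
dropIdx-∈ (c ∷ D) zero    p = ∈-++⁺ʳ c p
dropIdx-∈ (c ∷ D) (suc i) p with ∈-++⁻ c p
... | inj₁ q = ∈-++⁺ˡ q
... | inj₂ q = ∈-++⁺ʳ c (dropIdx-∈ D i q)

∈-snoc⁺ : ∀ (D : Boundary) {c x} → x ∈ concat D ⊎ x ∈ c → x ∈ concat (D ++ [ c ])
∈-snoc⁺ D (inj₁ p) = subst (_ ∈_) (concat-++ D _) (∈-++⁺ˡ p)
∈-snoc⁺ D {c} (inj₂ p) = subst (_ ∈_) (concat-++ D _) (∈-++⁺ʳ (concat D) (∈-++⁺ˡ p))

-- If x lies on the cut cycle only and not on the kept arc P, then exchanging x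
-- and k turns the new cycle P k into P x, a contraction of the cut cycle.
lost⇒repeats : ∀ {D gg k P r past} i → All (_< k) (concat D) → RotEq (lookup D i) r →
  (∀ {x} → x ∈ lookup D i → x ∉ P → (P ++ [ x ]) ⊆ r) → (∀ {x} → x ∈ P → x ∈ lookup D i) →
  Lost D (dropIdx (toℕ i) D ++ [ P ++ [ k ] ]) →
  Repeats (mkState D gg ∷ past) (mkState (dropIdx (toℕ i) D ++ [ P ++ [ k ] ]) gg)
lost⇒repeats {D} {gg} {k} {P} {r} i bd rt sub P⊆ lost
  with find lost
... | x , x∈D , x∉ = here (mkState (replace D i c') gg ,
        (contract-at D i c'⊆ c'≢[] , ≤-refl) , refl , transpose k x , transpose-injective k x , iso)
  where
  R = dropIdx (toℕ i) D
  x∉R : x ∉ concat R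
  x∉R p = x∉ (∈-snoc⁺ R (inj₁ p))
  x∉P : x ∉ P
  x∉P p = x∉ (∈-snoc⁺ R (inj₂ (∈-++⁺ˡ p)))
  in-cycle : ∀ (D : Boundary) i → x ∈ concat D → x ∉ concat (dropIdx (toℕ i) D) → x ∈ lookup D i
  in-cycle (c ∷ D) zero p q with ∈-++⁻ c p
  ... | inj₁ u = u
  ... | inj₂ u = contradiction u q
  in-cycle (c ∷ D) (suc i) p q with ∈-++⁻ c p
  ... | inj₁ u = contradiction (∈-++⁺ˡ u) q
  ... | inj₂ u = in-cycle D i u (q ∘ ∈-++⁺ʳ c)
  s = ⊆-rot rt (sub (in-cycle D i x∈D x∉R) x∉P)
  c' = proj₁ s
  c'⊆ = proj₁ (proj₂ s)
  c'rot = proj₂ (proj₂ s)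
  c'≢[] : c' ≢ []
  c'≢[] e with subst (λ w → RotEq (P ++ [ x ]) w) e c'rot
  ... | q with subst (x ∈_) refl (rot-∈ q (∈-++⁺ʳ P (here refl)))
  ...   | ()
  <k : ∀ {y} → y ∈ concat D → y ≢ k
  <k p refl = <-irrefl refl (All.lookup bd p)
  fixR : map (map (transpose k x)) R ≡ R
  fixR = map²-fix λ {y} p → transpose-other (<k (dropIdx-∈ D (toℕ i) p)) λ { refl → x∉R p }
  fixP : map (transpose k x) (P ++ [ k ]) ≡ P ++ [ x ]
  fixP = trans (map-++ _ P [ k ]) (cong₂ _++_
    (map-fix λ {y} p → transpose-other (<k (concat-∈ (∈-lookup {xs = D} i) (P⊆ p))) λ { refl → x∉P p })
    (cong [_] (transpose-left k x)))
  fix : map (map (transpose k x)) (R ++ [ P ++ [ k ] ]) ≡ R ++ [ P ++ [ x ] ]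
  fix = trans (map-++ _ R _) (cong₂ _++_ fixR (cong [_] fixP))
  iso : Iso (map (map (transpose k x)) (R ++ [ P ++ [ k ] ])) (replace D i c')
  iso = replace D i (P ++ [ x ]) , subst (_↭ _) (sym fix) (replace-↭ D i _) , replace-rot D i c'rot

rotate-rot : ∀ a c → RotEq c (rotate a c)
rotate-rot a c = take a c , drop a c , sym (take++drop≡id a c) , refl

-- Since `x` is on the cycle but not on `p`, it is on `q`; contracting the rest of `q` leaves the
-- edge `x` where the new edge would be.
arc-⊆ : ∀ (p q : Cycle) {x c r} → RotEq c r → r ≡ p ++ q → x ∈ c → x ∉ p → (p ++ [ x ]) ⊆ r
arc-⊆ p q rt refl x∈ x∉ with ∈-++⁻ p (rot-∈ rt x∈)
... | inj₁ u = contradiction u x∉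
... | inj₂ u = Subₚ.++⁺ ⊆-refl (from∈ u)

-- The second arc is treated as the first arc of the word rotated further. A cut at a dummy vertex
-- keeps all of `D`, so it loses nothing.
split-lost : ∀ {D gg k R C C' past} v w → split D v w k ≡ same R C C' → All (_< k) (concat D) →
  (Lost D (R ++ [ C ]) → Repeats (mkState D gg ∷ past) (mkState (R ++ [ C ]) gg)) ×
  (Lost D (R ++ [ C' ]) → Repeats (mkState D gg ∷ past) (mkState (R ++ [ C' ]) gg))
split-lost {D} (real i a) (real j b) e bd with toℕ i ≡ᵇ toℕ j | e
... | true | refl =
  lost⇒repeats i bd rt (arc-⊆ _ _ rt (sym (take++drop≡id d r))) back₁ ,
  lost⇒repeats i bd rt' (arc-⊆ _ _ rt' refl) back₂
  where
  c = lookup D i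
  r = rotate (toℕ a) c
  d = if toℕ a ≤ᵇ toℕ b then toℕ b ∸ toℕ a else (length c ∸ toℕ a) + toℕ b
  rt : RotEq c r
  rt = rotate-rot (toℕ a) c
  rt' : RotEq c (drop d r ++ take d r)
  rt' = rot-trans rt (rotate-rot d r)
  back₁ : ∀ {x} → x ∈ take d r → x ∈ c
  back₁ p = rot-∈ (rot-sym rt) (subst (_ ∈_) (take++drop≡id d r) (∈-++⁺ˡ p))
  back₂ : ∀ {x} → x ∈ drop d r → x ∈ c
  back₂ p = rot-∈ (rot-sym rt) (subst (_ ∈_) (take++drop≡id d r) (∈-++⁺ʳ (take d r) p))
split-lost {D} {k = k} dumV dumV refl bd = (λ l → contradiction l (none D)) , (λ l → contradiction l (none D))
  where
  none : ∀ D → ¬ Lost D (D ++ [ [ k ] ])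
  none D l with find l
  ... | x , x∈ , x∉ = x∉ (∈-snoc⁺ D (inj₁ x∈))
split-lost {D} {k = k} dumW dumW refl bd = split-lost {D} dumV dumV refl bd

All-dropIdx : ∀ {A : Set} {Q : A → Set} i {xs} → All Q xs → All Q (dropIdx i xs)
All-dropIdx i       []       = []
All-dropIdx zero    (p ∷ ps) = ps
All-dropIdx (suc i) (p ∷ ps) = p ∷ All-dropIdx i ps

All-dropIdx2 : ∀ {A : Set} {Q : A → Set} i j {xs} → All Q xs → All Q (dropIdx2 i j xs)
All-dropIdx2 i j ps with i <ᵇ j
... | true  = All-dropIdx i (All-dropIdx j ps)
... | false = All-dropIdx j (All-dropIdx i ps)

All-rotate : ∀ {Q : ℕ → Set} a {c} → All Q c → All Q (rotate a c)
All-rotate a ps = All-++⁺ (drop⁺ a ps) (take⁺ a ps)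

cycles : Split → Boundary
cycles (same R C C') = R ++ C ∷ C' ∷ []
cycles (diff R C)    = R ++ [ C ]

split-All : ∀ {Q : ℕ → Set} {D k} v w → Q k → All (All Q) D → All (All Q) (cycles (split D v w k))
split-All {D = D} (real i a) (real j b) q ps with toℕ i ≡ᵇ toℕ j
... | true = All-++⁺ (All-dropIdx (toℕ i) ps)
  (All-++⁺ (take⁺ d rs) (q ∷ []) ∷ All-++⁺ (drop⁺ d rs) (q ∷ []) ∷ [])
  where
  d = if toℕ a ≤ᵇ toℕ b then toℕ b ∸ toℕ a else (length (lookup D i) ∸ toℕ a) + toℕ b
  rs = All-rotate (toℕ a) (All.lookup ps (∈-lookup i))
... | false = All-++⁺ (All-dropIdx2 (toℕ i) (toℕ j) ps)
  (All-++⁺ (All-rotate (toℕ a) (All.lookup ps (∈-lookup i)))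
    (q ∷ All-++⁺ (All-rotate (toℕ b) (All.lookup ps (∈-lookup j))) (q ∷ [])) ∷ [])
split-All (real i a) dumV q ps = All-++⁺ (All-dropIdx (toℕ i) ps)
  (All-++⁺ (All-rotate (toℕ a) (All.lookup ps (∈-lookup i))) (q ∷ q ∷ []) ∷ [])
split-All (real i a) dumW q ps = split-All (real i a) dumV q ps
split-All dumV (real j b) q ps = All-++⁺ (All-dropIdx (toℕ j) ps)
  ((q ∷ All-++⁺ (All-rotate (toℕ b) (All.lookup ps (∈-lookup j))) (q ∷ [])) ∷ [])
split-All dumW (real j b) q ps = split-All dumV (real j b) q ps
split-All dumV dumV q ps = All-++⁺ ps ((q ∷ []) ∷ (q ∷ []) ∷ [])
split-All dumW dumW q ps = All-++⁺ ps ((q ∷ []) ∷ (q ∷ []) ∷ [])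
split-All dumV dumW q ps = All-++⁺ ps ((q ∷ q ∷ []) ∷ [])
split-All dumW dumV q ps = All-++⁺ ps ((q ∷ q ∷ []) ∷ [])

move-All : ∀ {Q : ℕ → Set} {s s' k} v w → CutterMove s v w k s' → Q k → All (All Q) (D s) → All (All Q) (D s')
move-All {Q} v w m q ps = from m (split-All v w q ps)
  where
  from : ∀ {s s' k v w} → CutterMove s v w k s' → All (All Q) (cycles (split (D s) v w k)) → All (All Q) (D s')
  from (moveA e _) as = subst (λ c → All (All Q) (cycles c)) e as
  from (moveB {R} e) as with subst (λ c → All (All Q) (cycles c)) e as
  ... | bs with All-++⁻ʳ R bs
  ...   | b ∷ _ = All-++⁺ (All-++⁻ˡ R bs) (b ∷ [])
  from (moveC {R} e) as with subst (λ c → All (All Q) (cycles c)) e as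
  ... | bs with All-++⁻ʳ R bs
  ...   | _ ∷ b ∷ _ = All-++⁺ (All-++⁻ˡ R bs) (b ∷ [])
  from (moveD e) as = subst (λ c → All (All Q) (cycles c)) e as

Wins-step : ∀ {n k s s' past} v w → All (All (_< k)) (D s) →
  Response (Wins n (suc k)) (D s) (g s) (split (D s) v w k) →
  CutterMove s v w k s' → ¬ Repeats (s ∷ past) s' → Wins n (suc k) s'
Wins-step {n} {k} {mkState D gg} v w bd r (moveA e refl) _ =
  proj₁ (subst (Response (Wins n (suc k)) D gg) e r)
Wins-step {n} {k} {mkState D gg} {past = past} v w bd r (moveB {R} {C} {C'} e) nr = from gg refl
  where
  keep₁ : Lost D (R ++ [ C ]) ⊎ Wins n (suc k) (mkState (R ++ [ C ]) gg) → Wins n (suc k) (mkState (R ++ [ C ]) gg)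
  keep₁ (inj₁ l) = contradiction (proj₁ (split-lost v w e (concat⁺ bd)) l) nr
  keep₁ (inj₂ q) = q
  -- `Response` only unfolds once the counter is known to be zero or a successor.
  from : ∀ h → gg ≡ h → Wins n (suc k) (mkState (R ++ [ C ]) gg)
  from zero    refl = keep₁ (proj₁ (subst (Response (Wins n (suc k)) D zero) e r))
  from (suc h) refl = keep₁ (proj₁ (proj₂ (subst (Response (Wins n (suc k)) D (suc h)) e r)))
Wins-step {n} {k} {mkState D gg} {past = past} v w bd r (moveC {R} {C} {C'} e) nr = from gg refl
  where
  keep₂ : Lost D (R ++ [ C' ]) ⊎ Wins n (suc k) (mkState (R ++ [ C' ]) gg) → Wins n (suc k) (mkState (R ++ [ C' ]) gg)
  keep₂ (inj₁ l) = contradiction (proj₂ (split-lost v w e (concat⁺ bd)) l) nr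
  keep₂ (inj₂ q) = q
  from : ∀ h → gg ≡ h → Wins n (suc k) (mkState (R ++ [ C' ]) gg)
  from zero    refl = keep₂ (proj₂ (subst (Response (Wins n (suc k)) D zero) e r))
  from (suc h) refl = keep₂ (proj₂ (proj₂ (subst (Response (Wins n (suc k)) D (suc h)) e r)))
Wins-step {n} {k} {mkState D gg} v w bd r (moveD e) _ = subst (Response (Wins n (suc k)) D gg) e r

-- The value is at most the number of moves

lookup-injective : ∀ {A : Set} {xs : List A} → Unique xs → Injective _≡_ _≡_ (lookup xs)
lookup-injective (p ∷ u) {zero}  {zero}  e = refl
lookup-injective (p ∷ u) {zero}  {suc j} e = contradiction e (All.lookup p (∈-lookup j))
lookup-injective (p ∷ u) {suc i} {zero}  e = contradiction (sym e) (All.lookup p (∈-lookup i))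
lookup-injective (p ∷ u) {suc i} {suc j} e = cong suc (lookup-injective u e)

unique-bounded : ∀ {k xs} → Unique xs → All (_< k) xs → length xs ≤ k
unique-bounded {k} {xs} u b = injective⇒≤ {f = λ i → fromℕ< (All.lookup b (∈-lookup i))}
  λ {i} {j} e → lookup-injective u (fromℕ<-injective _ _ _ _ e)

value-bounded : ∀ {k} s → All (All (_< k)) (D s) → value s ≤ k
value-bounded s b = unique-bounded (deduplicate-! (concat (D s)))
  (All.tabulate λ p → All.lookup (concat⁺ b) (∈-deduplicate⁻ _≟_ (concat (D s)) p))

-- Winning is decidable, so Marker's strategy searches for a winning move.
choose : ∀ n k s → Dec (Wins n k s) → Vtx (D s) × Vtx (D s)
choose (suc n) k s (yes (v , w , _)) = v , w
choose n       k s _                 = dumV , dumV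

search : ℕ → Strategy
search n past s = choose (n ∸ length past) (length past) s (Wins? (n ∸ length past) (length past) s)

choose-step : ∀ n k {s s' past} (d : Dec (Wins n k s)) → Wins n k s → All (All (_< k)) (D s) →
  CutterMove s (proj₁ (choose n k s d)) (proj₂ (choose n k s d)) k s' → ¬ Repeats (s ∷ past) s' →
  Wins (pred n) (suc k) s'
choose-step (suc n) k (yes (v , w , r)) _ b m nr = Wins-step v w b r m nr
choose-step (suc n) k (no c)            x b m nr = contradiction x c

-- A win persists along every play, so the default move of `choose` is never made.
search-invariant : ∀ {n g₀ past s} → Wins n 0 (mkState [] g₀) → Reachable (search n) g₀ past s →
  Wins (n ∸ length past) (length past) s × All (All (_< length past)) (D s)
search-invariant w start = w , []
search-invariant {n} w (step {past} {s} {s'} r m nr) with search-invariant w r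
... | v , b = subst (λ i → Wins i (suc k) s') (pred[m∸n]≡m∸[1+n] n k) (choose-step (n ∸ k) k (Wins? (n ∸ k) k s) v b m nr) ,
  move-All _ _ m (n<1+n _) (All.map (All.map m≤n⇒m≤1+n) b)
  where k = length past

Wins⇒positive : ∀ {n k s} → Wins n k s → 0 < n
Wins⇒positive {suc n} w = s≤s z≤n

-- At turn `k` a win within `suc n ∸ k` moves remains, which forces `k ≤ n`; and all labels in use
-- are below `k`.
strategy-from-wins : ∀ {n g₀} → Wins (suc n) 0 (mkState [] g₀) →
  Σ Strategy λ σ → ∀ past s → Reachable σ g₀ past s → value s ≤ n
strategy-from-wins {n} w = search (suc n) , λ past s r →
  let v , b = search-invariant w r
  in ≤-trans (value-bounded s b) (≤-pred (m∸n≢0⇒n<m (λ e → <-irrefl (sym e) (Wins⇒positive v))))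

-- Counting occurrences of labels

hit : ℕ → ℕ → ℕ
hit x y = if x ≡ᵇ y then 1 else 0

occ : ℕ → Cycle → ℕ
occ x []      = 0
occ x (y ∷ w) = hit x y + occ x w

occs : ℕ → Boundary → ℕ
occs x []      = 0
occs x (c ∷ D) = occ x c + occs x D

hit-refl : ∀ x → hit x x ≡ 1
hit-refl zero    = refl
hit-refl (suc x) = hit-refl x

hit-≢ : ∀ x y → x ≢ y → hit x y ≡ 0
hit-≢ zero    zero    n = contradiction refl n
hit-≢ zero    (suc y) n = refl
hit-≢ (suc x) zero    n = refl
hit-≢ (suc x) (suc y) n = hit-≢ x y (n ∘ cong suc)

occ-++ : ∀ x v w → occ x (v ++ w) ≡ occ x v + occ x w
occ-++ x []      w = refl
occ-++ x (y ∷ v) w = trans (cong (hit x y +_) (occ-++ x v w)) (sym (+-assoc (hit x y) _ _))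

occs-++ : ∀ x D E → occs x (D ++ E) ≡ occs x D + occs x E
occs-++ x []      E = refl
occs-++ x (c ∷ D) E = trans (cong (occ x c +_) (occs-++ x D E)) (sym (+-assoc (occ x c) _ _))

occ-rot : ∀ x {c d} → RotEq c d → occ x c ≡ occ x d
occ-rot x (v , w , refl , refl) = trans (occ-++ x v w) (trans (+-comm (occ x v) _) (sym (occ-++ x w v)))

occs-≈ : ∀ x {D E} → D ≈ E → occs x D ≡ occs x E
occs-≈ x (Perm.refl rs) = go rs
  where
  go : ∀ {D E} → Pointwise RotEq D E → occs x D ≡ occs x E
  go []       = refl
  go (r ∷ rs) = cong₂ _+_ (occ-rot x r) (go rs)
occs-≈ x (Perm.prep r p) = cong₂ _+_ (occ-rot x r) (occs-≈ x p)
occs-≈ x (Perm.swap {xs} {ys} {c} {d} {c'} {d'} r s p) = begin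
  occ x c + (occ x d + occs x xs)     ≡⟨ cong₂ _+_ (occ-rot x r) (cong₂ _+_ (occ-rot x s) (occs-≈ x p)) ⟩
  occ x c' + (occ x d' + occs x ys)   ≡⟨ +-assoc (occ x c') _ _ ⟨
  occ x c' + occ x d' + occs x ys     ≡⟨ cong (_+ occs x ys) (+-comm (occ x c') _) ⟩
  occ x d' + occ x c' + occs x ys     ≡⟨ +-assoc (occ x d') _ _ ⟩
  occ x d' + (occ x c' + occs x ys)   ∎
  where open ≡-Reasoning
occs-≈ x (Perm.trans p q) = trans (occs-≈ x p) (occs-≈ x q)

∈⇒occ : ∀ {x w} → x ∈ w → 0 < occ x w
∈⇒occ {x} {_ ∷ w} (here refl) rewrite hit-refl x = s≤s z≤n
∈⇒occ {x} {y ∷ w} (there p)   = <-≤-trans (∈⇒occ p) (m≤n+m _ (hit x y))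

∈⇒occs : ∀ {x D} → x ∈ concat D → 0 < occs x D
∈⇒occs {x} {c ∷ D} p with ∈-++⁻ c p
... | inj₁ q = <-≤-trans (∈⇒occ q) (m≤m+n _ _)
... | inj₂ q = <-≤-trans (∈⇒occs {D = D} q) (m≤n+m _ (occ x c))

occs≡0⇒∉ : ∀ {x} D → occs x D ≡ 0 → x ∉ concat D
occs≡0⇒∉ D e p = <-irrefl (sym e) (∈⇒occs {D = D} p)

record Valid (k : ℕ) (D : Boundary) : Set where
  field
    fresh  : ∀ {x} → k ≤ x → occs x D ≡ 0
    proper : ∀ x → occs x D ≤ 2
open Valid public

Valid-≈ : ∀ {k D E} → D ≈ E → Valid k D → Valid k E
Valid-≈ p v .fresh  {x} l = trans (sym (occs-≈ x p)) (fresh v l)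
Valid-≈ p v .proper x     = subst (_≤ 2) (occs-≈ x p) (proper v x)

-- Only labels older than `k` are compared: later ones are absent from `D₀`.
Shrinks : ℕ → Boundary → Boundary → Set
Shrinks k D₀ D = ∀ x → x < k → occs x D ≤ occs x D₀

-- Words over indices into a list of labels

nth : List ℕ → ℕ → ℕ
nth []       i       = 0
nth (x ∷ xs) zero    = x
nth (x ∷ xs) (suc i) = nth xs i

entry : {A : Set} → List (List A) → ℕ → List A
entry []       i       = []
entry (x ∷ xs) zero    = x
entry (x ∷ xs) (suc i) = entry xs i

⟦_⟧ : Boundary → List ℕ → Boundary
⟦ C ⟧ ρ = map (map (nth ρ)) C

nth-snoc-< : ∀ ρ {k i} → i < length ρ → nth (ρ ++ [ k ]) i ≡ nth ρ i
nth-snoc-< (x ∷ ρ) {i = zero}  p       = refl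
nth-snoc-< (x ∷ ρ) {i = suc i} (s≤s p) = nth-snoc-< ρ p

nth-snoc : ∀ ρ {k} → nth (ρ ++ [ k ]) (length ρ) ≡ k
nth-snoc []      = refl
nth-snoc (x ∷ ρ) = nth-snoc ρ

length-snoc : ∀ (ρ : List ℕ) {k} → length (ρ ++ [ k ]) ≡ suc (length ρ)
length-snoc []      = refl
length-snoc (x ∷ ρ) = cong suc (length-snoc ρ)

_∈ᵇ_ : ℕ → List ℕ → Bool
i ∈ᵇ is = any (i ≡ᵇ_) is

-- Side conditions on index words are Boolean so that, for the explicit words of the strategy, they
-- evaluate to `true` and the implicit proofs are found automatically.
wfᵇ : ℕ → Boundary → Bool
wfᵇ n = all (all (_<ᵇ n))

T-∧₁ : ∀ a {b} → T (a ∧ b) → T a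
T-∧₁ true p = tt

T-∧₂ : ∀ a {b} → T (a ∧ b) → T b
T-∧₂ true p = p

∈ᵇ-sound : ∀ {i} is → T (i ∈ᵇ is) → i ∈ is
∈ᵇ-sound {i} is t = Any.map (≡ᵇ⇒≡ i _) (any⁻ (i ≡ᵇ_) is t)

Wf : ℕ → Boundary → Set
Wf n = All (All (_< n))

wf-sound : ∀ n C → T (wfᵇ n C) → Wf n C
wf-sound n C t = All.map (λ {c} u → All.map (<ᵇ⇒< _ n) (all⁺ (_<ᵇ n) c u)) (all⁺ (all (_<ᵇ n)) C t)

map-snoc : ∀ ρ {k w} → All (_< length ρ) w → map (nth (ρ ++ [ k ])) w ≡ map (nth ρ) w
map-snoc ρ ps = map-cong-local (All.map (nth-snoc-< ρ) ps)

⟦⟧-snoc : ∀ ρ {k C} → Wf (length ρ) C → ⟦ C ⟧ (ρ ++ [ k ]) ≡ ⟦ C ⟧ ρ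
⟦⟧-snoc ρ []       = refl
⟦⟧-snoc ρ (p ∷ ps) = cong₂ _∷_ (map-snoc ρ p) (⟦⟧-snoc ρ ps)

map-new : ∀ ρ {k w} → All (_< length ρ) w →
  map (nth (ρ ++ [ k ])) (w ++ [ length ρ ]) ≡ map (nth ρ) w ++ [ k ]
map-new ρ {k} {w} ps = trans (map-++ _ w _) (cong₂ _++_ (map-snoc ρ ps) (cong [_] (nth-snoc ρ)))

Inj : List ℕ → Set
Inj ρ = ∀ i j → i < length ρ → j < length ρ → nth ρ i ≡ nth ρ j → i ≡ j

-- Core cycles given by words over the labels ρ, next to a context J. The
-- labels with index in ψ do not occur in J. D₀ is an earlier position.
record Env (k : ℕ) (ρ : List ℕ) (J C : Boundary) (ψ : List ℕ) (k₀ : ℕ) (D₀ : Boundary) : Set where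
  field
    valid   : Valid k (⟦ C ⟧ ρ ++ J)
    later   : k₀ ≤ k
    shrinks : Shrinks k₀ D₀ (⟦ C ⟧ ρ ++ J)
    inj     : Inj ρ
    bound   : ∀ {i} → i < length ρ → nth ρ i < k
    light   : ∀ {i} → i < length ρ → occs (nth ρ i) J ≤ 1
    clean   : All (λ i → i < length ρ × occs (nth ρ i) J ≡ 0) ψ
open Env public

-- Distinct indices carry distinct labels, so occurrences may be counted on index words.
occ-nth : ∀ ρ {i} → Inj ρ → i < length ρ → ∀ {w} → All (_< length ρ) w → occ (nth ρ i) (map (nth ρ) w) ≡ occ i w
occ-nth ρ inj p []       = refl
occ-nth ρ {i} inj p {j ∷ w} (q ∷ qs) with i ≟ j
... | yes refl = cong₂ _+_ (trans (hit-refl (nth ρ i)) (sym (hit-refl i))) (occ-nth ρ inj p qs)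
... | no n     = cong₂ _+_ (trans (hit-≢ _ _ (n ∘ inj _ _ p q)) (sym (hit-≢ i j n))) (occ-nth ρ inj p qs)

occs-nth : ∀ ρ {i} → Inj ρ → i < length ρ → ∀ {C} → Wf (length ρ) C → occs (nth ρ i) (⟦ C ⟧ ρ) ≡ occs i C
occs-nth ρ inj p []       = refl
occs-nth ρ inj p (q ∷ qs) = cong₂ _+_ (occ-nth ρ inj p q) (occs-nth ρ inj p qs)

privateᵇ : List ℕ → Cycle → Boundary → Bool
privateᵇ ψ P R = any (λ i → (i ∈ᵇ ψ) ∧ (occs i R ≡ᵇ 0)) P

-- Absence from `R` is computed on words; absence from `J` is what membership in `ψ` records. The
-- label is not `k` because all labels in `ρ` are older.
private-sound : ∀ {k ρ J C ψ k₀ D₀} → Env k ρ J C ψ k₀ D₀ → ∀ P R → Wf (length ρ) R →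
  T (privateᵇ ψ P R) → Private k (map (nth ρ) P) (⟦ R ⟧ ρ ++ J)
private-sound {ρ = ρ} {J} {ψ = ψ} e P R wf t with find (any⁻ _ P t)
... | i , i∈P , u with All.lookup (clean e) (∈ᵇ-sound ψ (T-∧₁ (i ∈ᵇ ψ) u))
...   | i< , c = nth ρ i , ∈-map⁺ (nth ρ) i∈P , (λ q → <-irrefl q (bound e i<)) ,
        occs≡0⇒∉ (⟦ R ⟧ ρ ++ J) (trans (occs-++ _ (⟦ R ⟧ ρ) J)
          (cong₂ _+_ (trans (occs-nth ρ (inj e) i< wf) (≡ᵇ⇒≡ _ 0 (T-∧₂ (i ∈ᵇ ψ) u))) c))

-- This much holds for every move, and it is all that an Env needs to survive.
record Adds (k : ℕ) (D D' : Boundary) : Set where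
  constructor adds
  field bounds : ∀ x → occs x D' ≤ occs x D + 2 * hit x k
open Adds public

Valid-adds : ∀ {k D D'} → Adds k D D' → Valid k D → Valid (suc k) D'
Valid-adds {k} {D} {D'} a v .fresh {x} l = n≤0⇒n≡0 (subst (occs x D' ≤_)
  (cong₂ (λ m n → m + 2 * n) (fresh v (<⇒≤ l)) (hit-≢ x k (λ { refl → <-irrefl refl l }))) (bounds a x))
Valid-adds {k} {D} a v .proper x with x ≟ k
... | yes refl = ≤-trans (bounds a x) (≤-reflexive (cong₂ (λ m n → m + 2 * n) (fresh v ≤-refl) (hit-refl x)))
... | no n     = ≤-trans (bounds a x) (subst (λ m → occs x D + 2 * m ≤ 2) (sym (hit-≢ x k n))
                   (subst (_≤ 2) (sym (+-identityʳ (occs x D))) (proper v x)))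

Shrinks-adds : ∀ {k k₀ D₀ D D'} → Adds k D D' → k₀ ≤ k → Shrinks k₀ D₀ D → Shrinks k₀ D₀ D'
Shrinks-adds {k} {D = D} a l s x p = ≤-trans (bounds a x) (≤-trans
  (≤-reflexive (trans (cong (λ n → occs x D + 2 * n) (hit-≢ x k (λ { refl → <-irrefl refl (≤-trans p l) }))) (+-identityʳ _)))
  (s x p))

-- The new label gets index `length ρ`. Being fresh, it differs from all entries of `ρ` and is
-- absent from `J`, so its index also joins `ψ`.
extend : ∀ {k ρ J C C' ψ k₀ D₀} → Env k ρ J C ψ k₀ D₀ →
  Adds k (⟦ C ⟧ ρ ++ J) (⟦ C' ⟧ (ρ ++ [ k ]) ++ J) →
  Env (suc k) (ρ ++ [ k ]) J C' (length ρ ∷ ψ) k₀ D₀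
extend {k} {ρ} {J} {C} {C'} {ψ} {D₀ = D₀} e a = record
  { valid   = Valid-adds a (valid e)
  ; later   = m≤n⇒m≤1+n (later e)
  ; shrinks = Shrinks-adds {D₀ = D₀} {D = ⟦ C ⟧ ρ ++ J} {D' = ⟦ C' ⟧ (ρ ++ [ k ]) ++ J} a (later e) (shrinks e)
  ; inj     = inj'
  ; bound   = bound'
  ; light   = light'
  ; clean   = (≤-reflexive (sym (length-snoc ρ)) , subst (λ x → occs x J ≡ 0) (sym (nth-snoc ρ)) freshJ)
            ∷ All.map (λ (l , c) → <-≤-trans l (subst (length ρ ≤_) (sym (length-snoc ρ)) (n≤1+n _)) ,
                subst (λ x → occs x J ≡ 0) (sym (nth-snoc-< ρ l)) c) (clean e)
  }
  where
  freshJ : occs k J ≡ 0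
  freshJ = m+n≡0⇒n≡0 (occs k (⟦ C ⟧ ρ)) (trans (sym (occs-++ k (⟦ C ⟧ ρ) J)) (fresh (valid e) ≤-refl))
  last : ∀ {i} → i < length (ρ ++ [ k ]) → i < length ρ ⊎ i ≡ length ρ
  last {i} p = m<1+n⇒m<n∨m≡n (subst (i <_) (length-snoc ρ) p)
  bound' : ∀ {i} → i < length (ρ ++ [ k ]) → nth (ρ ++ [ k ]) i < suc k
  bound' p with last p
  ... | inj₁ q    = m≤n⇒m≤1+n (subst (_< k) (sym (nth-snoc-< ρ q)) (bound e q))
  ... | inj₂ refl = ≤-reflexive (cong suc (nth-snoc ρ))
  light' : ∀ {i} → i < length (ρ ++ [ k ]) → occs (nth (ρ ++ [ k ]) i) J ≤ 1
  light' p with last p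
  ... | inj₁ q    = subst (λ x → occs x J ≤ 1) (sym (nth-snoc-< ρ q)) (light e q)
  ... | inj₂ refl = subst (λ x → occs x J ≤ 1) (sym (nth-snoc ρ)) (≤-trans (≤-reflexive freshJ) z≤n)
  inj' : Inj (ρ ++ [ k ])
  inj' i j p q eq with last p | last q
  ... | inj₁ r    | inj₁ s    = inj e i j r s (trans (sym (nth-snoc-< ρ r)) (trans eq (nth-snoc-< ρ s)))
  ... | inj₂ refl | inj₂ refl = refl
  ... | inj₁ r    | inj₂ refl = contradiction
    (trans (sym (nth-snoc-< ρ r)) (trans eq (nth-snoc ρ))) (<⇒≢ (bound e r))
  ... | inj₂ refl | inj₁ s    = contradiction
    (sym (trans (sym (nth-snoc ρ)) (trans eq (nth-snoc-< ρ s)))) (<⇒≢ (bound e s))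

-- Moves on core cycles

-- Cycle i of the core, started at its r-th edge and cut after d edges
module Arc (C : Boundary) (i r d : ℕ) where
  word = rotate r (entry C i)
  P = take d word
  Q = drop d word
  R = dropIdx i C

nth-pick : ∀ C i → T (i <ᵇ length C) → Pick C (entry C i) (dropIdx i C)
nth-pick (c ∷ C) zero    t = here
nth-pick (c ∷ C) (suc i) t = there (nth-pick C i t)

pick⇒≈ : ∀ {D c D'} → Pick D c D' → D ≈ c ∷ D'
pick⇒≈ here = ≈-refl
pick⇒≈ {c ∷ D} (there p) = ≈-trans (Perm.prep rot-refl (pick⇒≈ p)) (Perm.swap rot-refl rot-refl ≈-refl)

pick-map-++ : ∀ {C c C'} {f : Cycle → Cycle} J → Pick C c C' → Pick (map f C ++ J) (f c) (map f C' ++ J)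
pick-map-++ J here      = here
pick-map-++ J (there p) = there (pick-map-++ J p)

rot-map : ∀ f {c d} → RotEq c d → RotEq (map f c) (map f d)
rot-map f (xs , ys , refl , refl) = map f xs , map f ys , map-++ f xs ys , map-++ f ys xs

pull-≈ : ∀ ρ J C i r → T (i <ᵇ length C) →
  ⟦ C ⟧ ρ ++ J ≈ map (nth ρ) (rotate r (entry C i)) ∷ ⟦ dropIdx i C ⟧ ρ ++ J
pull-≈ ρ J C i r t = ≈-trans (pick⇒≈ (pick-map-++ J (nth-pick C i t)))
  (Perm.prep (rot-map (nth ρ) (rotate-rot r (entry C i))) ≈-refl)

arc-≈ : ∀ ρ J C i r d → T (i <ᵇ length C) → let open Arc C i r d in
  ⟦ C ⟧ ρ ++ J ≈ (map (nth ρ) P ++ map (nth ρ) Q) ∷ ⟦ R ⟧ ρ ++ J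
arc-≈ ρ J C i r d t = ≈-trans (pull-≈ ρ J C i r t)
  (Perm.prep (rot-≡ (trans (cong (map (nth ρ)) (sym (take++drop≡id d _))) (map-++ (nth ρ) (take d _) _))) ≈-refl)

wf-nth : ∀ {n C} i → Wf n C → All (_< n) (entry C i)
wf-nth i       []       = []
wf-nth zero    (p ∷ ps) = p
wf-nth (suc i) (p ∷ ps) = wf-nth i ps

occ-snoc : ∀ x w k → occ x (w ++ [ k ]) ≡ occ x w + hit x k
occ-snoc x w k = trans (occ-++ x w [ k ]) (cong (occ x w +_) (+-identityʳ (hit x k)))

adds-cut : ∀ {k D} p q R → D ≈ (p ++ q) ∷ R → Adds k D ((p ++ [ k ]) ∷ (q ++ [ k ]) ∷ R)
adds-cut {k} {D₁} p q R e = adds bound₁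
  where
  rearrange : ∀ a b c h → a + h + (b + h + c) ≡ a + b + c + 2 * h
  rearrange = solve-∀
  bound₁ : ∀ x → occs x ((p ++ [ k ]) ∷ (q ++ [ k ]) ∷ R) ≤ occs x D₁ + 2 * hit x k
  bound₁ x rewrite occs-≈ x e | occ-snoc x p k | occ-snoc x q k | occ-++ x p q =
    ≤-reflexive (rearrange (occ x p) (occ x q) (occs x R) (hit x k))

adds-keep : ∀ {k D} p q R → D ≈ (p ++ q) ∷ R → Adds k D ((p ++ [ k ]) ∷ R)
adds-keep {k} p q R e = adds λ x → ≤-trans
  (+-monoʳ-≤ (occ x (p ++ [ k ])) (m≤n+m (occs x R) (occ x (q ++ [ k ])))) (bounds (adds-cut p q R e) x)

adds-join : ∀ {k D} p q R → D ≈ p ∷ q ∷ R → Adds k D ((p ++ [ k ] ++ q ++ [ k ]) ∷ R)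
adds-join {k} {D₁} p q R e = adds bound₁
  where
  rearrange : ∀ a b c h → a + (h + (b + h)) + c ≡ a + (b + c) + 2 * h
  rearrange = solve-∀
  bound₁ : ∀ x → occs x ((p ++ [ k ] ++ q ++ [ k ]) ∷ R) ≤ occs x D₁ + 2 * hit x k
  bound₁ x rewrite occs-≈ x e | occ-++ x p ([ k ] ++ q ++ [ k ]) | occ-snoc x q k =
    ≤-reflexive (rearrange (occ x p) (occ x q) (occs x R) (hit x k))

adds-≡ : ∀ {k D E E'} → E ≡ E' → Adds k D E' → Adds k D E
adds-≡ refl a = a

T-∧₃ : ∀ a b {c} → T (a ∧ b ∧ c) → T c
T-∧₃ a b t = T-∧₂ b (T-∧₂ a t)

≢[]ᵇ : Cycle → Bool
≢[]ᵇ []      = false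
≢[]ᵇ (_ ∷ _) = true

map-≢[] : ∀ (f : ℕ → ℕ) w → T (≢[]ᵇ w) → map f w ≢ []
map-≢[] f (_ ∷ _) t ()

module _ {k ρ J C ψ k₀ D₀} (e : Env k ρ J C ψ k₀ D₀) (i r d : ℕ) where
  open Arc C i r d

  arcᵇ : Bool
  arcᵇ = (i <ᵇ length C) ∧ wfᵇ (length ρ) C ∧ ≢[]ᵇ Q

  cutᶜ keepᶜ : Boundary
  cutᶜ  = (P ++ [ length ρ ]) ∷ (Q ++ [ length ρ ]) ∷ R
  keepᶜ = (P ++ [ length ρ ]) ∷ R

  module _ (t : T arcᵇ) where
    private
      wfC = wf-sound (length ρ) C (T-∧₁ (wfᵇ (length ρ) C) (T-∧₂ (i <ᵇ length C) t))
      wfW = All-rotate r (wf-nth i wfC)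
      wfP = take⁺ d wfW
      wfQ = drop⁺ d wfW
      wfR = All-dropIdx i wfC
      p = map (nth ρ) P
      q = map (nth ρ) Q
    arc-iso = arc-≈ ρ J C i r d (T-∧₁ (i <ᵇ length C) t)

    cut-≡ : ⟦ cutᶜ ⟧ (ρ ++ [ k ]) ++ J ≡ (p ++ [ k ]) ∷ (q ++ [ k ]) ∷ ⟦ R ⟧ ρ ++ J
    cut-≡ = cong (_++ J) (cong₂ _∷_ (map-new ρ wfP) (cong₂ _∷_ (map-new ρ wfQ) (⟦⟧-snoc ρ wfR)))

    keep-≡ : ⟦ keepᶜ ⟧ (ρ ++ [ k ]) ++ J ≡ (p ++ [ k ]) ∷ ⟦ R ⟧ ρ ++ J
    keep-≡ = cong (_++ J) (cong₂ _∷_ (map-new ρ wfP) (⟦⟧-snoc ρ wfR))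

    cut-env : Env (suc k) (ρ ++ [ k ]) J cutᶜ (length ρ ∷ ψ) k₀ D₀
    cut-env = extend e (adds-≡ cut-≡ (adds-cut p q _ arc-iso))

    keep-env : Env (suc k) (ρ ++ [ k ]) J keepᶜ (length ρ ∷ ψ) k₀ D₀
    keep-env = extend e (adds-≡ keep-≡ (adds-keep p q _ arc-iso))

    private-P : T (privateᵇ ψ P (Q ∷ R)) → Private k p (q ∷ ⟦ R ⟧ ρ ++ J)
    private-P = private-sound e P (Q ∷ R) (wfQ ∷ wfR)

    private-Q : T (privateᵇ ψ Q (P ∷ R)) → Private k q (p ∷ ⟦ R ⟧ ρ ++ J)
    private-Q = private-sound e Q (P ∷ R) (wfP ∷ wfR)

    q≢[] : q ≢ []
    q≢[] = map-≢[] (nth ρ) Q (T-∧₃ (i <ᵇ length C) (wfᵇ (length ρ) C) t)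

  -- With private labels on both arcs, Cutter can only answer with (a).
  free : {t : T (arcᵇ ∧ privateᵇ ψ P (Q ∷ R) ∧ privateᵇ ψ Q (P ∷ R))} → ∀ {b g} →
    (∀ {h} → g ≡ suc h → Env (suc k) (ρ ++ [ k ]) J cutᶜ (length ρ ∷ ψ) k₀ D₀ →
      AWins (suc k) b h (⟦ cutᶜ ⟧ (ρ ++ [ k ]) ++ J)) →
    AWins k b g (⟦ C ⟧ ρ ++ J)
  free {t} f = cut (map (nth ρ) P) (map (nth ρ) Q) (⟦ R ⟧ ρ ++ J) (q≢[] u) (arc-iso u)
    (λ {h} eq → subst (AWins (suc k) _ h) (cut-≡ u) (f eq (cut-env u)))
    (inj₁ (private-Q u (T-∧₃ arcᵇ (privateᵇ ψ P (Q ∷ R)) t)))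
    (inj₁ (private-P u (T-∧₁ (privateᵇ ψ P (Q ∷ R)) (T-∧₂ arcᵇ t))))
    where u = T-∧₁ arcᵇ t

  -- With a private label on P, Cutter answers with (a) or keeps P.
  attack : {t : T (arcᵇ ∧ privateᵇ ψ P (Q ∷ R))} → ∀ {b g} →
    (∀ {h} → g ≡ suc h → Env (suc k) (ρ ++ [ k ]) J cutᶜ (length ρ ∷ ψ) k₀ D₀ →
      AWins (suc k) (suc b) h (⟦ cutᶜ ⟧ (ρ ++ [ k ]) ++ J)) →
    (Env (suc k) (ρ ++ [ k ]) J keepᶜ (length ρ ∷ ψ) k₀ D₀ →
      AWins (suc k) b g (⟦ keepᶜ ⟧ (ρ ++ [ k ]) ++ J)) →
    AWins k (suc b) g (⟦ C ⟧ ρ ++ J)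
  attack {t} f f' = cut (map (nth ρ) P) (map (nth ρ) Q) (⟦ R ⟧ ρ ++ J) (q≢[] u) (arc-iso u)
    (λ {h} eq → subst (AWins (suc k) _ h) (cut-≡ u) (f eq (cut-env u)))
    (inj₂ (_ , refl , subst (AWins (suc k) _ _) (keep-≡ u) (f' (keep-env u))))
    (inj₁ (private-P u (T-∧₂ arcᵇ t)))
    where u = T-∧₁ arcᵇ t

module _ {k ρ J C ψ k₀ D₀} (e : Env k ρ J C ψ k₀ D₀) where

  joinᶜ : Boundary → Boundary
  joinᶜ (c ∷ c' ∷ R) = (c ++ [ length ρ ] ++ c' ++ [ length ρ ]) ∷ R
  joinᶜ R            = R

  joinᵇ : Boundary → Bool
  joinᵇ (c ∷ c' ∷ R) = ≢[]ᵇ c ∧ ≢[]ᵇ c' ∧ wfᵇ (length ρ) (c ∷ c' ∷ R)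
  joinᵇ R            = false

join-≡ : ∀ ρ {k J} c c' R → Wf (length ρ) (c ∷ c' ∷ R) →
  ⟦ (c ++ [ length ρ ] ++ c' ++ [ length ρ ]) ∷ R ⟧ (ρ ++ [ k ]) ++ J ≡
  (map (nth ρ) c ++ [ k ] ++ map (nth ρ) c' ++ [ k ]) ∷ ⟦ R ⟧ ρ ++ J
join-≡ ρ {k} {J} c c' R (p ∷ q ∷ ps) = cong (_++ J) (cong₂ _∷_
  (trans (map-++ _ c _) (cong₂ _++_ (map-snoc ρ p) (cong₂ _∷_ (nth-snoc ρ) (map-new ρ q)))) (⟦⟧-snoc ρ ps))

join-core : ∀ {k ρ J C ψ k₀ D₀} (e : Env k ρ J C ψ k₀ D₀) → {t : T (joinᵇ e C)} → ∀ {b g} →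
  (Env (suc k) (ρ ++ [ k ]) J (joinᶜ e C) (length ρ ∷ ψ) k₀ D₀ →
    AWins (suc k) b g (⟦ joinᶜ e C ⟧ (ρ ++ [ k ]) ++ J)) →
  AWins k (suc b) g (⟦ C ⟧ ρ ++ J)
join-core {k} {ρ} {J} {c ∷ c' ∷ R} e {t} f =
  join (map (nth ρ) c) (map (nth ρ) c') (⟦ R ⟧ ρ ++ J)
    (map-≢[] (nth ρ) c (T-∧₁ (≢[]ᵇ c) t)) (map-≢[] (nth ρ) c' (T-∧₁ (≢[]ᵇ c') (T-∧₂ (≢[]ᵇ c) t))) ≈-refl
    (subst (AWins (suc k) _ _) eq (f (extend e (adds-≡ eq (adds-join (map (nth ρ) c) (map (nth ρ) c') _ ≈-refl)))))
  where
  eq = join-≡ ρ {k} {J} c c' R (wf-sound (length ρ) (c ∷ c' ∷ R) (T-∧₃ (≢[]ᵇ c) (≢[]ᵇ c') t))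

-- Reordering the core

-- Each (i , r) brings cycle i, started at its r-th edge, to the front.
pull : List (ℕ × ℕ) → Boundary → Boundary
pull []             C = C
pull ((i , r) ∷ is) C = pull is (rotate r (entry C i) ∷ dropIdx i C)

pullᵇ : List (ℕ × ℕ) → Boundary → Bool
pullᵇ []             C = true
pullᵇ ((i , r) ∷ is) C = (i <ᵇ length C) ∧ pullᵇ is (rotate r (entry C i) ∷ dropIdx i C)

pulls-≈ : ∀ ρ J is C → T (pullᵇ is C) → ⟦ C ⟧ ρ ++ J ≈ ⟦ pull is C ⟧ ρ ++ J
pulls-≈ ρ J []             C t = ≈-refl
pulls-≈ ρ J ((i , r) ∷ is) C t =
  ≈-trans (pull-≈ ρ J C i r (T-∧₁ (i <ᵇ length C) t)) (pulls-≈ ρ J is _ (T-∧₂ (i <ᵇ length C) t))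

-- Each pulled cycle goes to the front, so `is` lists cycles in reverse of their final order, with
-- indices that take the earlier pulls into account.
arrange : ∀ {k ρ J C ψ k₀ D₀} → Env k ρ J C ψ k₀ D₀ → ∀ is → {t : T (pullᵇ is C)} → ∀ {b g} →
  (Env k ρ J (pull is C) ψ k₀ D₀ → AWins k b g (⟦ pull is C ⟧ ρ ++ J)) → AWins k b g (⟦ C ⟧ ρ ++ J)
arrange {k} {ρ} {J} {C} e is {t} f = AWins-≈ p (f record
  { valid   = Valid-≈ p (valid e)
  ; later   = later e
  ; shrinks = λ x l → subst (_≤ _) (occs-≈ x p) (shrinks e x l)
  ; inj     = inj e
  ; bound   = bound e
  ; light   = light e
  ; clean   = clean e
  })
  where p = pulls-≈ ρ J is C t

-- Environments from occurrence counts

-- At most one occurrence, rather than exactly one, is a property that later moves cannot destroy.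
Solo : ℕ → ℕ → Boundary → Set
Solo k x D = x < k × occs x D ≤ 1

Solo-≈ : ∀ {k x D E} → D ≈ E → Solo k x D → Solo k x E
Solo-≈ {x = x} p (l , s) = l , subst (_≤ 1) (occs-≈ x p) s

Solo-later : ∀ {k ρ J C ψ k₀ D₀} → Env k ρ J C ψ k₀ D₀ → ∀ {x} → Solo k₀ x D₀ → Solo k x (⟦ C ⟧ ρ ++ J)
Solo-later e {x} (l , s) = <-≤-trans l (later e) , ≤-trans (shrinks e x l) s

-- A label not known to be absent from the context may occur there once, so it must have left the
-- core altogether.
soloᵇ : List ℕ → ℕ → Boundary → ℕ → Bool
soloᵇ ψ n C i = (i <ᵇ n) ∧ wfᵇ n C ∧ (if i ∈ᵇ ψ then occs i C ≤ᵇ 1 else occs i C ≡ᵇ 0)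

solo : ∀ {k ρ J C ψ k₀ D₀} → Env k ρ J C ψ k₀ D₀ → ∀ i → {t : T (soloᵇ ψ (length ρ) C i)} →
  Solo k (nth ρ i) (⟦ C ⟧ ρ ++ J)
solo {k} {ρ} {J} {C} {ψ} e i {t} = bound e i< , subst (_≤ 1) (sym count) (go (i ∈ᵇ ψ) refl (T-∧₃ (i <ᵇ length ρ) (wfᵇ (length ρ) C) t))
  where
  i< : i < length ρ
  i< = <ᵇ⇒< i _ (T-∧₁ (i <ᵇ length ρ) t)
  count : occs (nth ρ i) (⟦ C ⟧ ρ ++ J) ≡ occs i C + occs (nth ρ i) J
  count = trans (occs-++ _ (⟦ C ⟧ ρ) J) (cong (_+ occs (nth ρ i) J)
    (occs-nth ρ (inj e) i< (wf-sound (length ρ) C (T-∧₁ (wfᵇ (length ρ) C) (T-∧₂ (i <ᵇ length ρ) t)))))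
  go : ∀ b → i ∈ᵇ ψ ≡ b → T (if b then occs i C ≤ᵇ 1 else occs i C ≡ᵇ 0) → occs i C + occs (nth ρ i) J ≤ 1
  go true  q u = subst (λ n → occs i C + n ≤ 1)
    (sym (proj₂ (All.lookup (clean e) (∈ᵇ-sound ψ (subst T (sym q) tt)))))
    (subst (_≤ 1) (sym (+-identityʳ (occs i C))) (≤ᵇ⇒≤ _ 1 u))
  go false q u = subst (λ n → n + occs (nth ρ i) J ≤ 1) (sym (≡ᵇ⇒≡ _ 0 u)) (light e i<)

-- The three ways in which a core label cannot coincide with another one:
-- it occurs twice in the core, or once in the whole position, or once in the
-- core and once in the context.
data Tag : Set where
  twice once shared : Tag

Evidence : List ℕ → List Tag → (J D : Boundary) → Set
Evidence (x ∷ ρ) (twice ∷ ts)  J D = Evidence ρ ts J D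
Evidence (x ∷ ρ) (once ∷ ts)   J D = occs x D ≤ 1 × Evidence ρ ts J D
Evidence (x ∷ ρ) (shared ∷ ts) J D = 0 < occs x J × Evidence ρ ts J D
Evidence _       _             J D = ⊤

tag : List Tag → ℕ → Tag
tag []       i       = twice
tag (t ∷ ts) zero    = t
tag (t ∷ ts) (suc i) = tag ts i

need : Tag → ℕ
need twice  = 2
need once   = 1
need shared = 1

Fact : Tag → ℕ → (J D : Boundary) → Set
Fact twice  x J D = ⊤
Fact once   x J D = occs x D ≤ 1
Fact shared x J D = 0 < occs x J

evidence : ∀ ρ ts {J D} → length ts ≡ length ρ → Evidence ρ ts J D → ∀ i → i < length ρ → Fact (tag ts i) (nth ρ i) J D
evidence (x ∷ ρ) (twice ∷ ts)  l p       zero    q       = tt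
evidence (x ∷ ρ) (once ∷ ts)   l (p , _) zero    q       = p
evidence (x ∷ ρ) (shared ∷ ts) l (p , _) zero    q       = p
evidence (x ∷ ρ) (twice ∷ ts)  l p       (suc i) (s≤s q) = evidence ρ ts (suc-injective l) p i q
evidence (x ∷ ρ) (once ∷ ts)   l (_ , p) (suc i) (s≤s q) = evidence ρ ts (suc-injective l) p i q
evidence (x ∷ ρ) (shared ∷ ts) l (_ , p) (suc i) (s≤s q) = evidence ρ ts (suc-injective l) p i q

isShared : Tag → Bool
isShared shared = true
isShared _      = false

cleanIndices : List Tag → List ℕ → List ℕ
cleanIndices ts []       = []
cleanIndices ts (i ∷ is) = if isShared (tag ts i) then cleanIndices ts is else i ∷ cleanIndices ts is

envᵇ : List ℕ → List Tag → Boundary → Bool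
envᵇ ρ ts C = (length ts ≡ᵇ length ρ) ∧ all (λ i → need (tag ts i) ≤ᵇ occs i C) (upTo (length ρ))

occ-map-≥ : ∀ (f : ℕ → ℕ) i w → occ i w ≤ occ (f i) (map f w)
occ-map-≥ f i []      = z≤n
occ-map-≥ f i (y ∷ w) with i ≟ y
... | yes refl = +-mono-≤ (≤-reflexive (trans (hit-refl i) (sym (hit-refl (f i))))) (occ-map-≥ f i w)
... | no n     = ≤-trans (≤-reflexive (cong (_+ occ i w) (hit-≢ i y n)))
                   (≤-trans (occ-map-≥ f i w) (m≤n+m _ (hit (f i) (f y))))

occs-map-≥ : ∀ (f : ℕ → ℕ) i C → occs i C ≤ occs (f i) (map (map f) C)
occs-map-≥ f i []      = z≤n
occs-map-≥ f i (c ∷ C) = +-mono-≤ (occ-map-≥ f i c) (occs-map-≥ f i C)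

+-interchange : ∀ a b c d → (a + b) + (c + d) ≡ (a + c) + (b + d)
+-interchange = solve-∀

-- If two indices carried the same label, their occurrences would add up; `clash` shows that this is
-- too many.
occ-map₂-≥ : ∀ (f : ℕ → ℕ) {i j} → i ≢ j → f i ≡ f j → ∀ w → occ i w + occ j w ≤ occ (f i) (map f w)
occ-map₂-≥ f n e [] = z≤n
occ-map₂-≥ f {i} {j} n e (y ∷ w) = ≤-trans (≤-reflexive (+-interchange (hit i y) (occ i w) (hit j y) (occ j w)))
  (+-mono-≤ hits (occ-map₂-≥ f n e w))
  where
  hits : hit i y + hit j y ≤ hit (f i) (f y)
  hits with i ≟ y | j ≟ y
  ... | yes refl | yes refl = contradiction refl n
  ... | yes refl | no m     = ≤-reflexive (trans (cong₂ _+_ (hit-refl i) (hit-≢ j i m)) (sym (hit-refl (f i))))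
  ... | no m     | yes refl = ≤-reflexive (trans (cong₂ _+_ (hit-≢ i j m) (hit-refl j))
                                (sym (trans (cong (λ z → hit z (f j)) e) (hit-refl (f j)))))
  ... | no m     | no m'    = subst (_≤ hit (f i) (f y)) (sym (cong₂ _+_ (hit-≢ i y m) (hit-≢ j y m'))) z≤n

occs-map₂-≥ : ∀ (f : ℕ → ℕ) {i j} → i ≢ j → f i ≡ f j → ∀ C → occs i C + occs j C ≤ occs (f i) (map (map f) C)
occs-map₂-≥ f n e [] = z≤n
occs-map₂-≥ f {i} {j} n e (c ∷ C) = ≤-trans (≤-reflexive (+-interchange (occ i c) (occs i C) (occ j c) (occs j C)))
  (+-mono-≤ (occ-map₂-≥ f n e c) (occs-map₂-≥ f n e C))

module _ {k J} ρ C ts (v : Valid k (⟦ C ⟧ ρ ++ J)) (ev : Evidence ρ ts J (⟦ C ⟧ ρ ++ J)) (t : T (envᵇ ρ ts C)) where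
  private
    E = ⟦ C ⟧ ρ ++ J
    fact : ∀ i → i < length ρ → Fact (tag ts i) (nth ρ i) J E
    fact = evidence ρ ts (≡ᵇ⇒≡ _ _ (T-∧₁ (length ts ≡ᵇ length ρ) t)) ev
    needs : ∀ i → i < length ρ → need (tag ts i) ≤ occs i C
    needs i p = ≤ᵇ⇒≤ _ _
      (All.lookup (all⁺ _ (upTo (length ρ)) (T-∧₂ (length ts ≡ᵇ length ρ) t)) (∈-upTo⁺ p))
    need-pos : ∀ u → 1 ≤ need u
    need-pos twice  = s≤s z≤n
    need-pos once   = s≤s z≤n
    need-pos shared = s≤s z≤n
    total : ∀ x {m} → m ≤ occs x (⟦ C ⟧ ρ) → m + occs x J ≤ occs x E
    total x p = ≤-trans (+-monoˡ-≤ (occs x J) p) (≤-reflexive (sym (occs-++ x (⟦ C ⟧ ρ) J)))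

    -- A label needed twice and once more would occur three times; a `once` label would occur twice;
    -- two `shared` ones give two occurrences in the core and one in the context.
    clash : ∀ x u w {m n} → need u ≤ m → need w ≤ n → m + n + occs x J ≤ occs x E →
      Fact u x J E → Fact w x J E → ¬ (occs x E ≤ 2)
    clash x twice w p q le _ _ h =
      <⇒≱ (≤-trans (+-mono-≤ p (≤-trans (need-pos w) q)) (≤-trans (m≤m+n _ (occs x J)) le)) h
    clash x u twice p q le _ _ h =
      <⇒≱ (≤-trans (+-mono-≤ (≤-trans (need-pos u) p) q) (≤-trans (m≤m+n _ (occs x J)) le)) h
    clash x once w p q le s _ h = <⇒≱ (≤-trans (+-mono-≤ p (≤-trans (need-pos w) q)) (≤-trans (m≤m+n _ (occs x J)) le)) s
    clash x u once p q le _ s h = <⇒≱ (≤-trans (+-mono-≤ (≤-trans (need-pos u) p) q) (≤-trans (m≤m+n _ (occs x J)) le)) s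
    clash x shared shared p q le s _ h = <⇒≱ (≤-trans (+-mono-≤ (+-mono-≤ p q) s) le) h

    inj₀ : Inj ρ
    inj₀ i j p q eq with i ≟ j
    ... | yes r = r
    ... | no n = contradiction (proper v (nth ρ i)) (clash (nth ρ i) (tag ts i) (tag ts j) (needs i p) (needs j q)
      (total (nth ρ i) (occs-map₂-≥ (nth ρ) n eq C)) (fact i p)
      (subst (λ x → Fact (tag ts j) x J E) (sym eq) (fact j q)))

    clean₀ : ∀ is → All (_< length ρ) is → All (λ i → i < length ρ × occs (nth ρ i) J ≡ 0) (cleanIndices ts is)
    clean₀ []       []       = []
    clean₀ (i ∷ is) (p ∷ ps) with tag ts i | fact i p | needs i p
    ... | shared | _ | _ = clean₀ is ps
    ... | once   | s | n = (p , n≤0⇒n≡0 (≤-pred (≤-trans (total (nth ρ i) (≤-trans n (occs-map-≥ (nth ρ) i C))) s))) ∷ clean₀ is ps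
    ... | twice  | _ | n = (p , n≤0⇒n≡0 (≤-pred (≤-pred (≤-trans (total (nth ρ i) (≤-trans n (occs-map-≥ (nth ρ) i C))) (proper v _))))) ∷ clean₀ is ps

    light₀ : ∀ {i} → i < length ρ → occs (nth ρ i) J ≤ 1
    light₀ {i} p = ≤-pred (≤-trans (total (nth ρ i)
      (≤-trans (need-pos (tag ts i)) (≤-trans (needs i p) (occs-map-≥ (nth ρ) i C)))) (proper v (nth ρ i)))

    bound₀ : ∀ {i} → i < length ρ → nth ρ i < k
    bound₀ {i} p with nth ρ i <? k
    ... | yes q = q
    ... | no q = contradiction (fresh v (≮⇒≥ q)) (>⇒≢ (≤-trans
      (≤-trans (need-pos (tag ts i)) (≤-trans (needs i p) (occs-map-≥ (nth ρ) i C)))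
      (≤-trans (m≤m+n _ _) (total (nth ρ i) ≤-refl))))

  makeEnv : Env k ρ J C (cleanIndices ts (upTo (length ρ))) k E
  makeEnv = record
    { valid = v ; later = ≤-refl ; shrinks = λ x _ → ≤-refl ; inj = inj₀ ; bound = bound₀ ; light = light₀
    ; clean = clean₀ (upTo (length ρ)) (all-upTo (length ρ)) }

-- The reference position is the current one, so that `Solo-later` can carry facts about the context
-- through the following moves.
env : ∀ {k J} ρ C ts → Valid k (⟦ C ⟧ ρ ++ J) → Evidence ρ ts J (⟦ C ⟧ ρ ++ J) → {t : T (envᵇ ρ ts C)} →
  Env k ρ J C (cleanIndices ts (upTo (length ρ))) k (⟦ C ⟧ ρ ++ J)
env ρ C ts v ev {t} = makeEnv ρ C ts v ev t

-- Marker's strategy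

-- n * 3, in a form that reduces on successors
tri : ℕ → ℕ
tri zero    = 0
tri (suc n) = 3 + tri n

-- The singleton case avoids a trailing `++ []`, so that flattened blocks match the stated positions
-- definitionally.
flat : List Boundary → Boundary
flat []                = []
flat (D ∷ [])          = D
flat (D ∷ Ds@(_ ∷ _))  = D ++ flat Ds

extract : List ℕ → List Boundary → List Boundary
extract []       Ds = Ds
extract (i ∷ is) Ds = entry Ds i ∷ extract is (dropIdx i Ds)

extractᵇ : List ℕ → List Boundary → Bool
extractᵇ []       Ds = true
extractᵇ (i ∷ is) Ds = (i <ᵇ length Ds) ∧ extractᵇ is (dropIdx i Ds)

flat-∷ : ∀ D Ds → flat (D ∷ Ds) ≡ D ++ flat Ds
flat-∷ D []       = sym (++-identityʳ D)
flat-∷ D (E ∷ Ds) = refl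

flat-pick : ∀ Ds i → T (i <ᵇ length Ds) → flat Ds ↭ entry Ds i ++ flat (dropIdx i Ds)
flat-pick (D ∷ Ds) zero    t = P.↭-reflexive (flat-∷ D Ds)
flat-pick (D ∷ Ds) (suc i) t = P.↭-trans (P.↭-reflexive (flat-∷ D Ds)) (P.↭-trans (++⁺ˡ D (flat-pick Ds i t))
  (P.↭-trans (shifts D (entry Ds i))
    (P.↭-reflexive (cong (entry Ds i ++_) (sym (flat-∷ D (dropIdx i Ds)))))))

flat-extract : ∀ is Ds → T (extractᵇ is Ds) → flat Ds ↭ flat (extract is Ds)
flat-extract []       Ds t = P.↭-refl
flat-extract (i ∷ is) Ds t = P.↭-trans (flat-pick Ds i (T-∧₁ (i <ᵇ length Ds) t))
  (P.↭-trans (++⁺ˡ (entry Ds i) (flat-extract is (dropIdx i Ds) (T-∧₂ (i <ᵇ length Ds) t)))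
    (P.↭-reflexive (sym (flat-∷ (entry Ds i) (extract is (dropIdx i Ds))))))

reorder : ∀ is Ds → {t : T (extractᵇ is Ds)} → flat Ds ≈ flat (extract is Ds)
reorder is Ds {t} = ↭⇒≈ (flat-extract is Ds t)


cells : Boundary → List Boundary → List Boundary
cells []      Ds = Ds
cells (c ∷ C) Ds = [ c ] ∷ cells C Ds

flat-cells : ∀ C Ds → flat (cells C Ds) ≡ C ++ flat Ds
flat-cells []      Ds = refl
flat-cells (c ∷ C) Ds = trans (flat-∷ [ c ] (cells C Ds)) (cong (c ∷_) (flat-cells C Ds))

-- A position is also handled as a list of blocks, reordered by indices; here
-- every core cycle is a block of its own, followed by the blocks Ds.
regroup : ∀ {k ρ C ψ k₀ D₀} Ds → Env k ρ (flat Ds) C ψ k₀ D₀ → ∀ is → {t : T (extractᵇ is (cells (⟦ C ⟧ ρ) Ds))} → ∀ {b g} →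
  (Valid k (flat (extract is (cells (⟦ C ⟧ ρ) Ds))) →
   (∀ {x} → Solo k x (⟦ C ⟧ ρ ++ flat Ds) → Solo k x (flat (extract is (cells (⟦ C ⟧ ρ) Ds)))) →
   AWins k b g (flat (extract is (cells (⟦ C ⟧ ρ) Ds)))) →
  AWins k b g (⟦ C ⟧ ρ ++ flat Ds)
regroup {ρ = ρ} {C} Ds e is {t} f = AWins-≈ p (f (Valid-≈ p (valid e)) (Solo-≈ p))
  where
  p : ⟦ C ⟧ ρ ++ flat Ds ≈ flat (extract is (cells (⟦ C ⟧ ρ) Ds))
  p = ≈-trans (↭⇒≈ (P.↭-reflexive (sym (flat-cells (⟦ C ⟧ ρ) Ds)))) (reorder is (cells (⟦ C ⟧ ρ) Ds) {t})

-- Shapes of positions: ladders, trees and spare pairs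

occs-left : ∀ D E {x} → 0 < occs x D → 0 < occs x (D ++ E)
occs-left D E {x} p = <-≤-trans p (subst (occs x D ≤_) (sym (occs-++ x D E)) (m≤m+n _ _))

occs-right : ∀ D E {x} → 0 < occs x E → 0 < occs x (D ++ E)
occs-right D E {x} p = <-≤-trans p (subst (occs x E ≤_) (sym (occs-++ x D E)) (m≤n+m _ _))

-- A ladder: the two topmost cycles end with the labels a and b, and each pair
-- of cycles below is attached to the pair above it.
data Rungs : ℕ → ℕ → Boundary → Set where
  base : ∀ {s l m a b} → Rungs a b ((s ∷ l ∷ m ∷ a ∷ []) ∷ (s ∷ l ∷ m ∷ b ∷ []) ∷ [])
  next : ∀ {a' b' l m a b E} → Rungs a' b' E →
    Rungs a b ((a' ∷ l ∷ m ∷ a ∷ []) ∷ (b' ∷ l ∷ m ∷ b ∷ []) ∷ E)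

-- Used when one end of the top rung is cut off: mirroring the ladder puts the untouched end first.
Rungs-sym : ∀ {a b E} → Rungs a b E → ∃ λ E' → Rungs b a E' × E ↭ E'
Rungs-sym base = _ , base , P.swap _ _ P.↭-refl
Rungs-sym (next r) with Rungs-sym r
... | E' , r' , p = _ , next r' , P.swap _ _ p

rungs-left : ∀ {a b E} → Rungs a b E → 0 < occs a E
rungs-left {E = E} base     = ∈⇒occs {D = E} (there (there (there (here refl))))
rungs-left {E = E} (next r) = ∈⇒occs {D = E} (there (there (there (here refl))))

rungs-right : ∀ {a b E} → Rungs a b E → 0 < occs b E
rungs-right {E = E} base     = ∈⇒occs {D = E} (there (there (there (there (there (there (there (here refl))))))))
rungs-right {E = E} (next r) = ∈⇒occs {D = E} (there (there (there (there (there (there (there (here refl))))))))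

-- A caterpillar hanging at the label c, whose other ends are labels occurring
-- only once in D
data Tree (k : ℕ) (D : Boundary) : ℕ → ℕ → Boundary → Set where
  leaf : ∀ {y c} → Solo k y D → Tree k D 0 c ((y ∷ c ∷ []) ∷ [])
  node : ∀ {n t c r x y w T} → Solo k y D → Solo k w D → Tree k D n t T →
    Tree k D (suc n) c ((t ∷ c ∷ r ∷ x ∷ []) ∷ (y ∷ r ∷ []) ∷ (w ∷ x ∷ []) ∷ T)

Tree-map : ∀ {k k' D D' n c T} → (∀ {x} → Solo k x D → Solo k' x D') → Tree k D n c T → Tree k' D' n c T
Tree-map f (leaf s)     = leaf (f s)
Tree-map f (node s u t) = node (f s) (f u) (Tree-map f t)

tree-top : ∀ {k D n c T} → Tree k D n c T → 0 < occs c T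
tree-top {T = T} (leaf s)     = ∈⇒occs {D = T} (there (here refl))
tree-top {T = T} (node s u t) = ∈⇒occs {D = T} (there (here refl))

tri-pos : ∀ {n b} → suc n ≤ tri b → 1 ≤ b
tri-pos {b = suc b} p = s≤s z≤n

shift-≤ : ∀ c j {h n} → c + (j + h) ≤ j + n → c + h ≤ n
shift-≤ c j {h} {n} p = +-cancelˡ-≤ j _ _ (subst (_≤ j + n) (rearrange c j h) p)
  where
  rearrange : ∀ c j h → c + (j + h) ≡ j + (c + h)
  rearrange = solve-∀

-- The spare pairs, each of which can serve as the start of `pair-win`.
data Pairs (k : ℕ) (D : Boundary) : ℕ → Boundary → Set where
  none : Pairs k D 0 []
  more : ∀ {n u v s P} → Solo k u D → Solo k v D → Pairs k D n P →
    Pairs k D (suc n) ((u ∷ s ∷ []) ∷ (v ∷ s ∷ []) ∷ P)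

Pairs-map : ∀ {k k' D D' n P} → (∀ {x} → Solo k x D → Solo k' x D') → Pairs k D n P → Pairs k' D' n P
Pairs-map f none         = none
Pairs-map f (more s u p) = more (f s) (f u) (Pairs-map f p)

-- What remains of a position after the tree hanging from it is used up:
-- Target k D c m E, with an allowance of c and at most m moves (b), (c), (d).
data Target (k : ℕ) (D : Boundary) : ℕ → ℕ → Boundary → Set where
  pair  : ∀ {u v s m} → Solo k u D → Solo k v D → Target k D 3 m ((u ∷ s ∷ []) ∷ (v ∷ s ∷ []) ∷ [])
  rungs : ∀ {a t E m} → Rungs a t E → Solo k a D → Solo k t D → Target k D 1 m E
  pairs : ∀ {n P y r w x c} → Pairs k D n P → Solo k y D → Solo k w D → r ∈ c → x ∈ c →
    Target k D 2 (suc n) (P ++ (y ∷ r ∷ []) ∷ (w ∷ x ∷ []) ∷ c ∷ [])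

Target-map : ∀ {k k' D D' c m E} → (∀ {x} → Solo k x D → Solo k' x D') → Target k D c m E → Target k' D' c m E
Target-map f (pair s u)          = pair (f s) (f u)
Target-map f (rungs r s u)       = rungs r (f s) (f u)
Target-map f (pairs p s u r∈ x∈) = pairs (Pairs-map f p) (f s) (f u) r∈ x∈

-- Winning from each shape of position

pairs-win : ∀ {k b} g {n P y r w x c J} → let D = (P ++ (y ∷ r ∷ []) ∷ (w ∷ x ∷ []) ∷ c ∷ []) ++ J in
  Valid k D → Pairs k D n P → Solo k y D → Solo k w D → r ∈ c → x ∈ c →
  2 + g ≤ tri b → b ≤ suc n → AWins k b g D
pair-win : ∀ {k b} g {u v s J} → let D = (u ∷ s ∷ []) ∷ (v ∷ s ∷ []) ∷ J in
  Valid k D → Solo k u D → Solo k v D → 3 + g ≤ tri b → AWins k b g D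
ladder-win : ∀ {k b} g {a t u v E J} → let D = E ++ (u ∷ a ∷ []) ∷ (v ∷ t ∷ []) ∷ J in
  Valid k D → Rungs a t E → Solo k u D → Solo k v D → 3 + g ≤ tri b → AWins k b g D
rungs-win : ∀ {k b} g {a t E J} → let D = E ++ J in
  Valid k D → Rungs a t E → Solo k a D → Solo k t D → 1 + g ≤ tri b → AWins k b g D
-- The end `t` is cut off and carries a tree. There are as many spare pairs as tree nodes, so
-- whenever the tree is not a leaf a pair is at hand.
half-win : ∀ {k b} g {n a t E T P J} → let D = E ++ (T ++ (P ++ J)) in
  Valid k D → Rungs a t E → Solo k a D → Tree k D n t T → Pairs k D n P → 2 + g ≤ tri b → AWins k b g D
-- Marker cuts off `a`. The implication supplies what `star-win` and `tree-win` require after an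
-- answer (b), when the tree may have grown to `suc n` nodes.
half-attack : ∀ {k b} g {n a t E T P J} → let D = E ++ (T ++ (P ++ J)) in
  Valid k D → Rungs a t E → Solo k a D → Tree k D n t T → Pairs k D n P → 2 + g ≤ tri (suc b) →
  (1 ≤ tri b → suc n ≤ b) → AWins k (suc b) g D
-- Both ends are cut off. Over a leaf the two cut-off cycles make a new rung; over a larger tree a
-- spare pair, with the same allowance 3, is used instead.
half-cut : ∀ {k b} g {n a t u E T P J} → let D = E ++ (u ∷ a ∷ []) ∷ (T ++ (P ++ J)) in
  Valid k D → Rungs a t E → Solo k u D → Tree k D n t T → Pairs k D n P → 3 + g ≤ tri b → AWins k b g D
-- What an answer (b) leaves of a rung above `E`, with one pair more than tree nodes. Marker cuts
-- off `w`: after (a) the cycle becomes the root of a larger tree on `E`, evening the numbers; after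
-- (b) tree and ladder come apart.
star-win : ∀ {k b} g {n a t E T P J w c r y} → let D = (w ∷ t ∷ c ∷ r ∷ []) ∷ (y ∷ r ∷ []) ∷ (T ++ (E ++ (P ++ J))) in
  Valid k D → Rungs a c E → Solo k a D → Solo k w D → Solo k y D → Tree k D n t T → Pairs k D (suc n) P →
  1 + g ≤ tri b → suc n ≤ b → AWins k b g D
-- Marker cuts off the top label. An answer (a) repays the excess of one over `tri b`. An answer (b)
-- is followed by three forced (a), paying for it, and descends to the subtree; at a leaf there is a
-- fourth. Thus `b` must cover the depth `suc n`.
tree-win : ∀ {k b} g {n m t E T J c} → let D = T ++ (E ++ J) in
  Valid k D → Tree k D (suc n) t T → Solo k t D → Target k D c m E →
  c + g ≤ suc (tri b) → suc n ≤ b → b ≤ m → AWins k b g D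
finish : ∀ {k b} g {m E J c} → let D = E ++ J in
  Valid k D → Target k D c m E → c + g ≤ tri b → b ≤ m → AWins k b g D

finish g v (pair s u)             p q = pair-win g v s u p
finish g v (rungs r s u)          p q = rungs-win g v r s u p
finish g v (pairs ps s u r∈ x∈) p q = pairs-win g v ps s u r∈ x∈ p q

pair-win {b = suc b} g {u} {w} {s} v su sw (s≤s (s≤s (s≤s p))) =
  join-core (env (u ∷ w ∷ s ∷ []) ((0 ∷ 2 ∷ []) ∷ (1 ∷ 2 ∷ []) ∷ []) (once ∷ once ∷ twice ∷ []) v
    (proj₂ su , proj₂ sw , tt)) λ e →
  free e 0 0 3 λ { {h} refl e →
  arrange e ((1 , 1) ∷ (1 , 1) ∷ []) λ e →
  rungs-win h (valid e) base (solo e 0) (solo e 1) p }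

ladder-win {b = suc b} g {a} {t} {u} {w} {E} {J} v r su sw (s≤s (s≤s (s≤s p))) =
  AWins-≈ q (
  join-core (env (u ∷ a ∷ w ∷ t ∷ []) ((0 ∷ 1 ∷ []) ∷ (2 ∷ 3 ∷ []) ∷ []) (once ∷ shared ∷ once ∷ shared ∷ [])
    (Valid-≈ q v) (proj₂ (Solo-≈ q su) , occs-left E J (rungs-left r) ,
      proj₂ (Solo-≈ q sw) , occs-left E J (rungs-right r) , tt)) λ e →
  free e 0 0 3 λ { {h} refl e →
  arrange e ((1 , 1) ∷ (1 , 1) ∷ []) λ e →
  rungs-win h (valid e) (next r) (solo e 0) (solo e 2) p })
  where
  q : E ++ (u ∷ a ∷ []) ∷ (w ∷ t ∷ []) ∷ J ≈ (u ∷ a ∷ []) ∷ (w ∷ t ∷ []) ∷ (E ++ J)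
  q = reorder (1 ∷ 1 ∷ []) (E ∷ [ u ∷ a ∷ [] ] ∷ [ w ∷ t ∷ [] ] ∷ J ∷ [])

rungs-win {b = suc b} g {J = J} v (base {s} {l} {m} {a} {t}) sa st (s≤s p) =
  attack (env (s ∷ l ∷ m ∷ a ∷ t ∷ []) ((0 ∷ 1 ∷ 2 ∷ 3 ∷ []) ∷ (0 ∷ 1 ∷ 2 ∷ 4 ∷ []) ∷ [])
    (twice ∷ twice ∷ twice ∷ once ∷ once ∷ []) v (proj₂ sa , proj₂ st , tt)) 0 3 1
  (λ { {h} refl e →
    arrange e ((0 , 0) ∷ (1 , 0) ∷ (2 , 0) ∷ []) λ e →
    half-win h {P = []} (valid e) base (solo e 4) (leaf (solo e 3)) none (s≤s p) })
  (λ e →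
    -- After (b) the labels `s`, `l`, `m` occur once each, so four cuts are forced; they leave a
    -- one-node tree and a pair.
    free e 0 0 1 λ { refl e →
    free e 2 1 1 λ { refl e →
    free e 1 0 1 λ { refl e →
    free e 1 0 1 λ { {h} refl e →
    arrange e ((2 , 0) ∷ (3 , 0) ∷ (3 , 3) ∷ []) λ e →
    tree-win h (valid e) (node (solo e 1) (solo e 2) (leaf (solo e 4))) (solo e 0)
      (pair (solo e 3) (solo e 5)) (s≤s (≤-pred (≤-pred p))) (tri-pos (≤-pred (≤-pred p))) ≤-refl }}}})
rungs-win {b = suc b} g {J = J} v (next {a'} {b'} {l} {m} {a} {t} {E} r) sa st (s≤s p) =
  attack (env (a' ∷ l ∷ m ∷ a ∷ b' ∷ t ∷ []) ((0 ∷ 1 ∷ 2 ∷ 3 ∷ []) ∷ (4 ∷ 1 ∷ 2 ∷ 5 ∷ []) ∷ [])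
    (shared ∷ twice ∷ twice ∷ once ∷ shared ∷ once ∷ []) v
    (occs-left E J (rungs-left r) , proj₂ sa , occs-left E J (rungs-right r) , proj₂ st , tt)) 0 3 1
  (λ { {h} refl e →
    arrange e ((1 , 0) ∷ (2 , 0) ∷ []) λ e →
    regroup (E ∷ J ∷ []) e (0 ∷ 0 ∷ 1 ∷ []) λ v σ →
    let E' , r' , s = Rungs-sym r
        q = ↭⇒≈ (P.prep _ (P.prep _ (++⁺ʳ _ s)))
        τ = λ {x} → Solo-≈ {x = x} q
    in AWins-≈ q (half-win h {P = []} (Valid-≈ q v) (next r') (τ (σ (solo e 5)))
      (leaf (τ (σ (solo e 3)))) none (s≤s p)) })
  (λ e →
    free e 0 0 1 λ { refl e →
    free e 2 1 1 λ { refl e →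
    free e 1 1 1 λ { {h} refl e →
    arrange e ((2 , 0) ∷ (2 , 2) ∷ []) λ e →
    regroup (E ∷ J ∷ []) e (0 ∷ 0 ∷ 0 ∷ 2 ∷ []) λ v σ →
    star-win h v r (σ (solo e 0)) (σ (solo e 2)) (σ (solo e 1)) (leaf (σ (solo e 5)))
      (more (σ (solo e 3)) (σ (solo e 6)) none) (≤-pred (≤-pred p)) (tri-pos (≤-pred (≤-pred p))) }}})

half-win {b = suc b} g v r sa t@(leaf _) ps p = half-attack g v r sa t ps p tri-pos
half-win {b = suc b} g {n = suc n} {E = E} {P = P} {J} v r sa
  t@(node {t = t'} {c} {r'} {x} {y} {w} {T} sy sw _) ps p with suc b ≤? suc (suc n)
... | no q  = half-attack g v r sa t ps p (λ _ → ≤-pred (≰⇒> q))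
... | yes q = AWins-≈ i (pairs-win g (Valid-≈ i v) (Pairs-map (Solo-≈ i) ps) (Solo-≈ i sy) (Solo-≈ i sw)
    (there (there (here refl))) (there (there (there (here refl)))) p q)
  where
  c₁ = t' ∷ c ∷ r' ∷ x ∷ []
  c₂ = y ∷ r' ∷ []
  c₃ = w ∷ x ∷ []
  i : E ++ (c₁ ∷ c₂ ∷ c₃ ∷ T) ++ (P ++ J) ≈ (P ++ c₂ ∷ c₃ ∷ c₁ ∷ []) ++ (E ++ (T ++ J))
  i = ≈-trans (reorder (5 ∷ 2 ∷ 2 ∷ 1 ∷ []) (E ∷ [ c₁ ] ∷ [ c₂ ] ∷ [ c₃ ] ∷ T ∷ P ∷ J ∷ []))
    (↭⇒≈ (P.↭-reflexive (sym (++-assoc P (c₂ ∷ c₃ ∷ c₁ ∷ []) (E ++ (T ++ J))))))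

half-cut g v r su (leaf sy) ps p = ladder-win g v r su sy p
half-cut g {a = a} {u = u} {E} {T} {J = J} v r su (node _ _ _) (more {u = u'} {v'} {s} {P} s₁ s₂ _) p =
  AWins-≈ q (pair-win g (Valid-≈ q v) (Solo-≈ q s₁) (Solo-≈ q s₂) p)
  where
  q : E ++ (u ∷ a ∷ []) ∷ (T ++ (((u' ∷ s ∷ []) ∷ (v' ∷ s ∷ []) ∷ P) ++ J)) ≈
    (u' ∷ s ∷ []) ∷ (v' ∷ s ∷ []) ∷ (E ++ (u ∷ a ∷ []) ∷ (T ++ (P ++ J)))
  q = reorder (3 ∷ 3 ∷ []) (E ∷ [ u ∷ a ∷ [] ] ∷ T ∷ [ u' ∷ s ∷ [] ] ∷ [ v' ∷ s ∷ [] ] ∷ P ∷ J ∷ [])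

half-attack {b = b} g {T = T} {P} {J} v (base {s} {l} {m} {a} {t}) sa tr ps (s≤s (s≤s p)) n≤ =
  attack (env (s ∷ l ∷ m ∷ a ∷ t ∷ []) ((0 ∷ 1 ∷ 2 ∷ 3 ∷ []) ∷ (0 ∷ 1 ∷ 2 ∷ 4 ∷ []) ∷ [])
    (twice ∷ twice ∷ twice ∷ once ∷ shared ∷ []) v (proj₂ sa , occs-left T (P ++ J) (tree-top tr) , tt)) 0 3 1
  (λ { {h} refl e →
    arrange e ((2 , 0) ∷ (2 , 0) ∷ []) λ e →
    half-cut h (valid e) base (solo e 3) (Tree-map (Solo-later e) tr) (Pairs-map (Solo-later e) ps) (s≤s (s≤s p)) })
  (λ e →
    free e 0 0 1 λ { refl e →
    free e 2 1 1 λ { refl e →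
    free e 1 0 1 λ { {h} refl e →
    arrange e ((2 , 0) ∷ (2 , 0) ∷ []) λ e →
    regroup (T ∷ (P ++ J) ∷ []) e (0 ∷ 0 ∷ 0 ∷ 2 ∷ []) λ v σ →
    tree-win h v (node (σ (solo e 1)) (σ (solo e 2)) (Tree-map (σ ∘ Solo-later e) tr)) (σ (solo e 0))
      (pair (σ (solo e 3)) (σ (solo e 5))) (s≤s (≤-pred p)) (n≤ (≤-trans (s≤s z≤n) (≤-pred p))) ≤-refl }}})
half-attack {b = b} g {T = T} {P} {J} v (next {a'} {b'} {l} {m} {a} {t} {E} r) sa tr ps (s≤s (s≤s p)) n≤ =
  attack (env (a' ∷ l ∷ m ∷ a ∷ b' ∷ t ∷ []) ((0 ∷ 1 ∷ 2 ∷ 3 ∷ []) ∷ (4 ∷ 1 ∷ 2 ∷ 5 ∷ []) ∷ [])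
    (shared ∷ twice ∷ twice ∷ once ∷ shared ∷ shared ∷ []) v
    (occs-left E _ (rungs-left r) , proj₂ sa , occs-left E _ (rungs-right r) ,
      occs-right E _ (occs-left T (P ++ J) (tree-top tr)) , tt)) 0 3 1
  (λ { {h} refl e →
    arrange e ((2 , 0) ∷ (2 , 0) ∷ []) λ e →
    regroup (E ∷ (T ++ (P ++ J)) ∷ []) e (0 ∷ 0 ∷ 1 ∷ []) λ v σ →
    half-cut h v (next r) (σ (solo e 3)) (Tree-map (σ ∘ Solo-later e) tr) (Pairs-map (σ ∘ Solo-later e) ps) (s≤s (s≤s p)) })
  (λ e →
    free e 0 0 1 λ { refl e →
    free e 2 1 1 λ { {h} refl e →
    arrange e ((1 , 0) ∷ []) λ e →
    regroup (E ∷ T ∷ (P ++ J) ∷ []) e (0 ∷ 0 ∷ 3 ∷ 2 ∷ []) λ v σ →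
    star-win h v r (σ (solo e 0)) (σ (solo e 2)) (σ (solo e 1)) (Tree-map (σ ∘ Solo-later e) tr)
      (more (σ (solo e 3)) (σ (solo e 6)) (Pairs-map (σ ∘ Solo-later e) ps)) (≤-pred p)
      (n≤ (≤-trans (s≤s z≤n) (≤-pred p))) }})

star-win {b = suc b} g {t = t} {E} {P = P} {J} {w} {c} {r} {y} v rs sa sw sy (leaf {y'} sy') ps (s≤s p) q =
  attack (env (w ∷ t ∷ c ∷ r ∷ y ∷ y' ∷ []) ((0 ∷ 1 ∷ 2 ∷ 3 ∷ []) ∷ (4 ∷ 3 ∷ []) ∷ (5 ∷ 1 ∷ []) ∷ [])
    (once ∷ twice ∷ shared ∷ twice ∷ once ∷ once ∷ []) v
    (proj₂ sw , occs-left E (P ++ J) (rungs-right rs) , proj₂ sy , proj₂ sy' , tt)) 0 0 1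
  (λ { {h} refl e →
    arrange e ((2 , 0) ∷ (2 , 0) ∷ []) λ e →
    regroup (E ∷ (P ++ J) ∷ []) e (4 ∷ []) λ v σ →
    half-win h v rs (σ (Solo-later e sa)) (node (σ (solo e 4)) (σ (solo e 0)) (leaf (σ (solo e 5))))
      (Pairs-map (σ ∘ Solo-later e) ps) (s≤s p) })
  (λ e →
    free e 0 0 1 λ { refl e →
    free e 2 0 1 λ { refl e →
    free e 4 0 1 λ { {h} refl e →
    regroup (E ∷ (P ++ J) ∷ []) e (6 ∷ []) λ v σ →
    rungs-win h v rs (σ (Solo-later e sa)) (σ (solo e 2)) (≤-pred (≤-pred p)) }}})
star-win {b = suc b} g {t = t} {E} {T} {P} {J} {w} {c} {r} {y} v rs sa sw sy tr@(node _ _ _) ps (s≤s p) (s≤s q) =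
  attack (env (w ∷ t ∷ c ∷ r ∷ y ∷ []) ((0 ∷ 1 ∷ 2 ∷ 3 ∷ []) ∷ (4 ∷ 3 ∷ []) ∷ [])
    (once ∷ shared ∷ shared ∷ twice ∷ once ∷ []) v
    (proj₂ sw , occs-left T (E ++ (P ++ J)) {t} (tree-top tr) ,
      occs-right T (E ++ (P ++ J)) {c} (occs-left E (P ++ J) (rungs-right rs)) , proj₂ sy , tt)) 0 0 1
  (λ { {h} refl e →
    arrange e ((2 , 0) ∷ (2 , 0) ∷ []) λ e →
    regroup (T ∷ E ∷ (P ++ J) ∷ []) e (4 ∷ []) λ v σ →
    half-win h v rs (σ (Solo-later e sa)) (node (σ (solo e 4)) (σ (solo e 0)) (Tree-map (σ ∘ Solo-later e) tr))
      (Pairs-map (σ ∘ Solo-later e) ps) (s≤s p) })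
  (λ e →
    free e 0 0 1 λ { refl e →
    free e 2 0 1 λ { {h} refl e →
    regroup (T ∷ E ∷ (P ++ J) ∷ []) e (4 ∷ 4 ∷ []) λ v σ →
    tree-win h v (Tree-map (σ ∘ Solo-later e) tr) (σ (solo e 1)) (rungs rs (σ (Solo-later e sa)) (σ (solo e 2)))
      (s≤s (≤-pred (≤-pred p))) q ≤-refl }})

tree-win {b = suc b} g {E = E} {J = J} {c = n} v (node {t = t} {c} {r} {x} {y} {w} sy sw (leaf {y'} sy')) st tg p (s≤s q) b≤ =
  attack (env (t ∷ c ∷ r ∷ x ∷ y ∷ w ∷ y' ∷ [])
    ((0 ∷ 1 ∷ 2 ∷ 3 ∷ []) ∷ (4 ∷ 2 ∷ []) ∷ (5 ∷ 3 ∷ []) ∷ (6 ∷ 0 ∷ []) ∷ [])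
    (twice ∷ once ∷ twice ∷ twice ∷ once ∷ once ∷ once ∷ []) v
    (proj₂ st , proj₂ sy , proj₂ sw , proj₂ sy' , tt)) 0 1 1
  (λ { {h} refl e →
    regroup (E ∷ J ∷ []) e (5 ∷ []) λ v σ →
    finish h v (Target-map (σ ∘ Solo-later e) tg) (shift-≤ n 1 p) b≤ })
  (λ e →
    free e 0 0 1 λ { refl e →
    free e 2 0 1 λ { refl e →
    free e 4 0 1 λ { refl e →
    free e 6 0 1 λ { {h} refl e →
    regroup (E ∷ J ∷ []) e (8 ∷ []) λ v σ →
    finish h v (Target-map (σ ∘ Solo-later e) tg) (shift-≤ n 4 p) (≤-trans (n≤1+n b) b≤) }}}})
tree-win {b = suc b} g {E = E} {J = J} {c = n} v (node {t = t} {c} {r} {x} {y} {w} {T} sy sw tr@(node _ _ _)) st tg p (s≤s q) b≤ =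
  attack (env (t ∷ c ∷ r ∷ x ∷ y ∷ w ∷ [])
    ((0 ∷ 1 ∷ 2 ∷ 3 ∷ []) ∷ (4 ∷ 2 ∷ []) ∷ (5 ∷ 3 ∷ []) ∷ [])
    (shared ∷ once ∷ twice ∷ twice ∷ once ∷ once ∷ []) v
    (occs-left T (E ++ J) {t} (tree-top tr) , proj₂ st , proj₂ sy , proj₂ sw , tt)) 0 1 1
  (λ { {h} refl e →
    regroup (T ∷ E ∷ J ∷ []) e (5 ∷ []) λ v σ →
    finish h v (Target-map (σ ∘ Solo-later e) tg) (shift-≤ n 1 p) b≤ })
  (λ e →
    free e 0 0 1 λ { refl e →
    free e 2 0 1 λ { refl e →
    free e 4 0 1 λ { {h} refl e →
    regroup (T ∷ E ∷ J ∷ []) e (6 ∷ 6 ∷ []) λ v σ →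
    tree-win h v (Tree-map (σ ∘ Solo-later e) tr) (σ (solo e 0)) (Target-map (σ ∘ Solo-later e) tg)
      (shift-≤ n 3 p) q (≤-trans (n≤1+n b) b≤) }}})

-- One join suffices: it allows two successive cuts that force (a), and the counter cannot pay for
-- both.
end-win : ∀ {k b} g {y r w x J} → let D = (y ∷ r ∷ []) ∷ (w ∷ x ∷ []) ∷ J in
  Valid k D → Solo k y D → Solo k w D → 0 < occs r J → 0 < occs x J → g ≤ 1 → AWins k (suc b) g D
end-win g {y} {r} {w} {x} v sy sw r∈ x∈ g≤ =
  join-core (env (y ∷ r ∷ w ∷ x ∷ []) ((0 ∷ 1 ∷ []) ∷ (2 ∷ 3 ∷ []) ∷ []) (once ∷ shared ∷ once ∷ shared ∷ []) v
    (proj₂ sy , r∈ , proj₂ sw , x∈ , tt)) λ e →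
  free e 0 0 1 λ { refl e →
  free e 1 2 1 λ { refl e → contradiction g≤ λ { (s≤s ()) } }}

pairs-win {b = suc b} g {P = P} {y} {r} {w} {x} {c} {J} v ps sy sw r∈ x∈ p q with g ≤? 1
... | yes g≤ = AWins-≈ i (end-win g (Valid-≈ i v) (Solo-≈ i sy) (Solo-≈ i sw) (inside r∈) (inside x∈) g≤)
  where
  i : (P ++ (y ∷ r ∷ []) ∷ (w ∷ x ∷ []) ∷ c ∷ []) ++ J ≈ (y ∷ r ∷ []) ∷ (w ∷ x ∷ []) ∷ (P ++ c ∷ J)
  i = ≈-trans (↭⇒≈ (P.↭-reflexive (++-assoc P _ J)))
    (reorder (1 ∷ 1 ∷ []) (P ∷ [ y ∷ r ∷ [] ] ∷ [ w ∷ x ∷ [] ] ∷ (c ∷ J) ∷ []))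
  inside : ∀ {z} → z ∈ c → 0 < occs z (P ++ c ∷ J)
  inside z∈ = occs-right P (c ∷ J) (<-≤-trans (∈⇒occ z∈) (m≤m+n _ _))
pairs-win {b = suc zero} zero v ps sy sw r∈ x∈ p q | no g> = contradiction z≤n g>
pairs-win {b = suc zero} (suc zero) v ps sy sw r∈ x∈ p q | no g> = contradiction ≤-refl g>
pairs-win {b = suc zero} (suc (suc g)) v ps sy sw r∈ x∈ (s≤s (s≤s (s≤s ()))) q | no g>
pairs-win {b = suc (suc b)} g {J = J} v none sy sw r∈ x∈ p (s≤s ()) | no g>
pairs-win {b = suc (suc b)} g {y = y} {r} {w} {x} {c} {J} v (more {n} {u} {z} {s} {P} s₁ s₂ ps) sy sw r∈ x∈ (s≤s (s≤s p)) (s≤s (s≤s q)) | no g> =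
  join-core (env (u ∷ z ∷ s ∷ []) ((0 ∷ 2 ∷ []) ∷ (1 ∷ 2 ∷ []) ∷ []) (once ∷ once ∷ twice ∷ []) v
    (proj₂ s₁ , proj₂ s₂ , tt)) λ e →
  free e 0 0 3 λ { refl e →
  attack e 0 0 1
  (λ { refl e →
    -- Two answers (a) here, with the forced one before, repay the join exactly, and the pair is
    -- discarded into the context.
    attack e 2 0 1
    (λ { {h} refl e →
      regroup (E ∷ J ∷ []) e (4 ∷ []) λ v σ →
      pairs-win h v (Pairs-map (σ ∘ Solo-later e) ps) (σ (Solo-later e sy)) (σ (Solo-later e sw)) r∈ x∈
        (≤-pred p) (s≤s q) })
    (λ e →
      free e 0 0 1 λ { refl e →
      free e 3 0 1 λ { refl e →
      free e 1 0 1 λ { {h} refl e →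
      arrange e ((2 , 0) ∷ (5 , 0) ∷ (3 , 3) ∷ []) λ e →
      regroup (E ∷ J ∷ []) e (0 ∷ 0 ∷ 0 ∷ 0 ∷ 2 ∷ []) λ v σ →
      tree-win h v (node (σ (solo e 0)) (σ (solo e 2)) (leaf (σ (solo e 3)))) (σ (solo e 4))
        (pairs (Pairs-map (σ ∘ Solo-later e) ps) (σ (Solo-later e sy)) (σ (Solo-later e sw)) r∈ x∈)
        (s≤s (≤-pred (≤-pred (≤-pred (≤-pred p))))) (tri-pos (≤-pred (≤-pred (≤-pred (≤-pred p))))) (m≤n⇒m≤1+n q) }}}) })
  (λ e →
    free e 0 0 1 λ { refl e →
    free e 2 0 1 λ { refl e →
    free e 1 0 1 λ { refl e →
    free e 1 0 1 λ { {h} refl e →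
    arrange e ((2 , 0) ∷ (3 , 0) ∷ (3 , 3) ∷ []) λ e →
    regroup (E ∷ J ∷ []) e (0 ∷ 0 ∷ 0 ∷ 0 ∷ 2 ∷ []) λ v σ →
    tree-win h v (node (σ (solo e 1)) (σ (solo e 2)) (leaf (σ (solo e 3)))) (σ (solo e 4))
      (pairs (Pairs-map (σ ∘ Solo-later e) ps) (σ (Solo-later e sy)) (σ (Solo-later e sw)) r∈ x∈)
      (s≤s (≤-pred (≤-pred (≤-pred (≤-pred p))))) (tri-pos (≤-pred (≤-pred (≤-pred (≤-pred p))))) (m≤n⇒m≤1+n q) }}}}) }
  where
  E = P ++ (y ∷ r ∷ []) ∷ (w ∷ x ∷ []) ∷ c ∷ []

-- The opening, from the empty position to a pair

adds-new : ∀ {k D} n → n ≤ 2 → ∀ C → (∀ x → occs x C ≡ n * hit x k) → Adds k D (C ++ D)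
adds-new {k} {D} n n≤2 C e = adds λ x → ≤-trans (≤-reflexive (trans (occs-++ x C D) (+-comm (occs x C) (occs x D))))
  (+-monoʳ-≤ (occs x D) (≤-trans (≤-reflexive (e x)) (*-monoˡ-≤ (hit x k) n≤2)))

-- Marker cuts off `x`. An answer (a) recreates the shape with a smaller counter, the new label
-- being attached to the other piece; an answer (b) leaves a cycle whose forced cut gives a pair.
attached-win : ∀ {k b} g {x y J} → let D = (x ∷ y ∷ []) ∷ J in
  Valid k D → Solo k x D → 0 < occs y J → 6 + g ≤ tri b → AWins k b g D
attached-win {b = suc b} g {x} {y} {J} v s p (s≤s (s≤s (s≤s q))) =
  attack (env (x ∷ y ∷ []) ((0 ∷ 1 ∷ []) ∷ []) (once ∷ shared ∷ []) v (proj₂ s , p , tt)) 0 0 1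
    (λ { {h} refl e → attached-win h {J = (y ∷ _ ∷ []) ∷ J} (valid e) (solo e 0)
      (∈⇒occs {D = (y ∷ _ ∷ []) ∷ J} (there (here refl))) (s≤s (s≤s (s≤s (≤-trans (n≤1+n _) q)))) })
    (λ e → free e 0 0 1 λ { {h} refl e → pair-win h (valid e) (solo e 0) (solo e 2) (≤-trans (n≤1+n _) q) })

single-win : ∀ {k b} g {x J} → let D = (x ∷ []) ∷ J in
  Valid k D → Solo k x D → 5 + g ≤ tri b → AWins k b g D
single-win {k} {suc b} g {x} {J} v s (s≤s (s≤s (s≤s q))) =
  -- Both ends of the cut are the same vertex, so `P` is empty; keeping it would lose `x`.
  cut [] (x ∷ []) J (λ ()) ≈-refl
    (λ { {h} refl → let e' = cut-env e 0 0 0 tt in arrange e' ((1 , 0) ∷ []) λ e →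
      attached-win h (valid e) (solo e 0) (∈⇒occs {D = (k ∷ []) ∷ J} (here refl)) (s≤s (s≤s (s≤s q))) })
    (inj₁ (x , here refl , <⇒≢ (proj₁ s) , occs≡0⇒∉ ([] ∷ J) (proj₂ (All.head (clean e)))))
    (inj₂ (b , refl , free e'' 0 0 1 λ { {h} refl e → pair-win h (valid e) (solo e 0) (solo e 1) q }))
  where
  e : Env k (x ∷ []) J ((0 ∷ []) ∷ []) (0 ∷ []) k ((x ∷ []) ∷ J)
  e = env (x ∷ []) ((0 ∷ []) ∷ []) (once ∷ []) v (proj₂ s , tt)
  e'' : Env (suc k) (x ∷ k ∷ []) J ((0 ∷ 1 ∷ []) ∷ []) (1 ∷ 0 ∷ []) k ((x ∷ []) ∷ J)
  e'' = extend e (adds-keep (x ∷ []) [] J ≈-refl)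

-- Marker plays a dummy vertex until (a) is refused; the loops made so far pile up in `D`. The
-- refusal lowers the allowance from 8 to 5 and leaves a loop with a label of its own.
initial-win : ∀ {k b} g {D} → Valid k D → 8 + g ≤ tri b → AWins k b g D
initial-win {k} {suc b} g {D} v (s≤s (s≤s (s≤s q))) = dummy
  (λ { {h} refl → initial-win h (Valid-adds (adds-new 2 ≤-refl ([ k ] ∷ [ k ] ∷ []) λ x → two (hit x k)) v)
    (s≤s (s≤s (s≤s (≤-trans (n≤1+n _) q)))) })
  (single-win g (Valid-adds (adds-new 1 (s≤s z≤n) ([ k ] ∷ []) λ x → one (hit x k)) v)
    (≤-refl , ≤-reflexive (trans (cong (λ n → n + 0 + occs k D) (hit-refl k)) (cong suc (fresh v ≤-refl)))) q)
  where
  one : ∀ h → h + 0 + 0 ≡ 1 * h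
  one = solve-∀
  two : ∀ h → h + 0 + (h + 0 + 0) ≡ 2 * h
  two = solve-∀

-- The final count

tri-* : ∀ n → tri n ≡ n * 3
tri-* zero    = refl
tri-* (suc n) = cong (3 +_) (tri-* n)

theorem5p6 : (g₀ : ℕ) → 1 ≤ g₀ →
    Σ Strategy λ σ → (past : List State) (s : State) →
    Reachable σ g₀ past s → 3 * value s ≤ 4 * g₀ + 10
theorem5p6 g₀ _ = proj₁ σ , λ past s r → ≤-trans (*-monoʳ-≤ 3 (proj₂ σ past s r)) length-bound
  where
  -- Rounding down loses at most 2, so the opening allowance 8 becomes 10.
  b = (g₀ + 10) / 3
  σ = strategy-from-wins {b + g₀} {g₀} (AWins⇒Wins (initial-win g₀ {D = []} empty enough))
    where
    empty : Valid 0 []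
    empty .fresh  l = refl
    empty .proper x = z≤n
    enough : 8 + g₀ ≤ tri b
    enough = +-cancelˡ-≤ 2 _ _ (begin
      2 + (8 + g₀)               ≡⟨ +-comm 10 g₀ ⟩
      g₀ + 10                    ≡⟨ m≡m%n+[m/n]*n (g₀ + 10) 3 ⟩
      (g₀ + 10) % 3 + b * 3      ≤⟨ +-monoˡ-≤ (b * 3) (≤-pred (m%n<n (g₀ + 10) 3)) ⟩
      2 + b * 3                  ≡⟨ cong (2 +_) (tri-* b) ⟨
      2 + tri b                  ∎)
      where open ≤-Reasoning
  length-bound : 3 * (b + g₀) ≤ 4 * g₀ + 10
  length-bound = begin
    3 * (b + g₀)            ≡⟨ split-3 b g₀ ⟩
    b * 3 + 3 * g₀          ≤⟨ +-monoˡ-≤ (3 * g₀) (m/n*n≤m (g₀ + 10) 3) ⟩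
    g₀ + 10 + 3 * g₀        ≡⟨ collect g₀ ⟩
    4 * g₀ + 10             ∎
    where
    open ≤-Reasoning
    split-3 : ∀ b g → 3 * (b + g) ≡ b * 3 + 3 * g
    split-3 = solve-∀
    collect : ∀ g → g + 10 + 3 * g ≡ 4 * g + 10
    collect = solve-∀
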